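{- Let $n \ge 1$ be an integer and let $Q^{(n)}$ be the $n$-cube. Then $$f(Q^{(n)}) = 2^{n-1} - \sum_{m=0}^{n-2} \binom{m}{\lfloor m/2 \rfloor},$$ where an empty sum (for $n=1$) is $0$.
   Context: The $n$-cube $Q^{(n)}$ is the graph with vertex set $\{0,1\}^n$, two vertices being adjacent iff they differ in exactly one coordinate. A numbering of a graph $G=(V,E)$ is a bijection $\eta: V \to \{1,2,\dots,|V|\}$. The antibandwidth of $G$ is $$f(G) = \max_{\eta} \min_{\{v,w\}\in E} |\eta(v)-\eta(w)|,$$ the maximum being over all numberings $\eta$ of $G$. -}

module Defs where

open import Data.Nat using (ℕ; zero; suc; _+_; _∸_; _^_; _≤_; _/_)
open import Data.Nat.Combinatorics using (_C_)
open import Data.Bool using (Bool; true; false)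
open import Data.Fin using (Fin; toℕ)
open import Data.Vec using (Vec; []; _∷_)
open import Data.Product using (Σ; ∃; _×_; _,_)
open import Function.Bundles using (_⤖_; Bijection)
open import Relation.Binary.PropositionalEquality using (_≡_)

∣_-_∣ : ℕ → ℕ → ℕ
∣ a - b ∣ = (a ∸ b) + (b ∸ a)

hamming : ∀ {n} → Vec Bool n → Vec Bool n → ℕ
hamming [] [] = 0
hamming (true ∷ xs) (true ∷ ys) = hamming xs ys
hamming (false ∷ xs) (false ∷ ys) = hamming xs ys
hamming (true ∷ xs) (false ∷ ys) = suc (hamming xs ys)
hamming (false ∷ xs) (true ∷ ys) = suc (hamming xs ys)

Vertex : ℕ → Set
Vertex n = Vec Bool n

Adj : ∀ n → Vertex n → Vertex n → Set
Adj n v w = hamming v w ≡ 1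

-- A numbering: bijection V → {1,…,|V|}, represented as V ⤖ Fin |V|
-- (labels shifted by one; differences are unaffected).
Numbering : ℕ → Set
Numbering n = Vertex n ⤖ Fin (2 ^ n)

label : ∀ {n} → Numbering n → Vertex n → ℕ
label η v = toℕ (Bijection.to η v)

AllEdgesAtLeast : ∀ n → Numbering n → ℕ → Set
AllEdgesAtLeast n η k = ∀ v w → Adj n v w → k ≤ ∣ label η v - label η w ∣

-- f(Q^(n)) = k : k is the maximum over numberings of the minimum edge difference.
-- (Q^(n) has edges for n ≥ 1, so the min is attained by some edge.)
AntibandwidthCubeIs : ℕ → ℕ → Set
AntibandwidthCubeIs n k =
  (Σ (Numbering n) λ η → AllEdgesAtLeast n η k) ×
  (∀ (η : Numbering n) → ∃ λ v → ∃ λ w → Adj n v w × ∣ label η v - label η w ∣ ≤ k)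

centralSum : ℕ → ℕ
centralSum zero = 0
centralSum (suc N) = centralSum N + (N C (N / 2))

{-# OPTIONS --safe #-}
-- Project the even and the odd vertices of the (n+1)-cube onto the n-cube by dropping the first
-- coordinate: an edge joins an even and an odd vertex whose projections are equal or adjacent.
--
-- Lower bound.  Number the even vertices by the simplicial order of the n-cube, then the odd ones in
-- the same way.  The gap along an edge is at least 2^n minus the bandwidth of the simplicial order.
-- The earliest vertex of the closed neighbourhood of v is obtained by deleting the last true
-- coordinate of v, and this lowers the rank by a sum of one binomial coefficient m C _ for each m < n.
--
-- Upper bound.  Suppose that all gaps are at least k = 2^n - B + 1, where B = centralSum n.  By Harper's
-- theorem (proved by compressions) there are sizes t′ ≤ t with t + t′ = k and t ≤ t′ + B such that every
-- set of t or t′ vertices of the n-cube has at least B outer neighbours.  Let E x and O x count the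
-- even and the odd vertices among the first x labels, and put h x = E x + E (x + k) - x.  The
-- expansion property says: if E (c + k) - E a is t or t′ then h c < h a, and if O (c + k) - O a is
-- t or t′ then h a < h c.  Taking a = c, no window of k consecutive labels contains exactly t or t′ even
-- vertices.  Taking for a the minimum of h, a discrete intermediate value argument shows that some window,
-- and then every window, contains more than t vertices of one fixed colour.  The extremum of h over an
-- initial interval then contradicts that both colours have 2^n vertices.
module Submission where

open import Defs
open import Data.Bool using (Bool; true; false; not; T; _∧_; _∨_; _xor_)
import Data.Bool as Bool
open import Data.Bool.Properties using (T?; T-∧; T-∨; ∨-assoc; ∨-comm; not-involutive)
open import Data.Empty using (⊥; ⊥-elim)
open import Data.Fin using (Fin; zero; suc; toℕ; fromℕ<)
open import Data.Fin.Properties using (any?; toℕ<n; toℕ-injective; toℕ-fromℕ<)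
open import Data.Nat using (ℕ; zero; suc; _+_; _*_; _∸_; _^_; _/_; _≤_; _<_; z≤n; s≤s;
  _≤ᵇ_; _<ᵇ_; _≡ᵇ_; _≤?_; _<?_; _≟_)
open import Data.Nat.Combinatorics using (_C_; nCk+nC[k+1]≡[n+1]C[k+1]; nCk≡nC[n∸k]; k>n⇒nCk≡0)
open import Data.Nat.DivMod using (m/n≡1+[m∸n]/n)
open import Data.Nat.Properties hiding (_≤?_; _<?_; _≟_)
open import Data.Nat.Tactic.RingSolver using (ring; solve-∀)
open import Data.Product using (_×_; _,_; ∃; proj₁; proj₂)
open import Data.Sum using (_⊎_; inj₁; inj₂)
open import Data.Unit using (tt)
open import Data.Vec using ([]; _∷_; insertAt; removeAt; lookup)
open import Data.Vec.Properties using (∷-injectiveʳ; removeAt-insertAt; insertAt-lookup; insertAt-removeAt)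
open import Function using (_∘_)
open import Function.Bundles using (Equivalence; Bijection; mk⤖)
open import Relation.Binary.Definitions using (tri<; tri≈; tri>)
open import Relation.Binary.PropositionalEquality
open import Relation.Nullary using (¬_; Dec; yes; no; contradiction)
open import Relation.Nullary.Decidable using (_×-dec_; _⊎-dec_; ¬?; map′; toWitness)
open import Tactic.RingSolver.NonReflective ring using (solve; _⊕_; _⊜_; Κ)

infixr 5 _+≤_

_+≤_ : ∀ {a b c d} → a ≤ b → c ≤ d → a + c ≤ b + d
_+≤_ = +-mono-≤

-- Linear arithmetic: with A ≤ B the sum of the hypotheses, only a semiring identity is left to check.
≤-from : ∀ {a b A B} → A ≤ B → a + B ≡ b + A → a ≤ b
≤-from {a} {b} {A} {B} A≤B eq = +-cancelʳ-≤ A a b (≤-trans (+-monoʳ-≤ a A≤B) (≤-reflexive eq))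

-- The walk counting both colours

argmin : ∀ (f : ℕ → ℕ) N → ∃ λ m → m ≤ N × (∀ x → x ≤ N → f m ≤ f x)
argmin f zero = 0 , z≤n , λ { zero _ → ≤-refl }
argmin f (suc N) with argmin f N
... | m , m≤N , least with f m ≤? f (suc N)
...   | yes p = m , m≤n⇒m≤1+n m≤N , λ x x≤ → case-≤ x (m≤n⇒m<n∨m≡n x≤)
  where
  case-≤ : ∀ x → x < suc N ⊎ x ≡ suc N → f m ≤ f x
  case-≤ x (inj₁ (s≤s q)) = least x q
  case-≤ x (inj₂ refl) = p
...   | no ¬p = suc N , ≤-refl , λ x x≤ → case-≤ x (m≤n⇒m<n∨m≡n x≤)
  where
  case-≤ : ∀ x → x < suc N ⊎ x ≡ suc N → f (suc N) ≤ f x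
  case-≤ x (inj₁ (s≤s q)) = ≤-trans (<⇒≤ (≰⇒> ¬p)) (least x q)
  case-≤ x (inj₂ refl) = ≤-refl

-- A discrete intermediate value theorem: rising by at most one per step, `f` cannot pass `y`
-- without taking that value.
skips : ∀ (f : ℕ → ℕ) y a d → (∀ x → f (suc x) ≤ suc (f x)) →
        (∀ x → a ≤ x → x ≤ d + a → f x ≢ y) → f a ≤ y → f (d + a) < y
skips f y a zero    step avoid fa≤y = ≤∧≢⇒< fa≤y (avoid a ≤-refl ≤-refl)
skips f y a (suc d) step avoid fa≤y =
  ≤∧≢⇒< (≤-trans (step (d + a))
          (skips f y a d step (λ x l u → avoid x l (m≤n⇒m≤1+n u)) fa≤y))
        (avoid (suc d + a) (m≤n+m a (suc d)) ≤-refl)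

-- E x and O x count the even and the odd vertices among the first x labels; there are k + β = 2^n
-- vertices of each colour, where suc β is the bandwidth.
record Walk (k β : ℕ) (E O : ℕ → ℕ) : Set where
  field
    total  : ∀ x → x ≤ k + β + β + k → E x + O x ≡ x
    E-mono : ∀ x → E x ≤ E (suc x)
    E-step : ∀ x → E (suc x) ≤ suc (E x)
    O-mono : ∀ x → O x ≤ O (suc x)
    O-step : ∀ x → O (suc x) ≤ suc (O x)
    E-end  : E (k + β + β + k) ≡ k + β
    O-end  : O (k + β + β + k) ≡ k + β

swap : ∀ {k β E O} → Walk k β E O → Walk k β O E
swap {E = E} {O} w = record
  { total = λ x x≤ → trans (+-comm (O x) (E x)) (total x x≤)
  ; E-mono = O-mono ; E-step = O-step ; O-mono = E-mono ; O-step = E-step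
  ; E-end = O-end ; O-end = E-end }
  where open Walk w

-- What the isoperimetric inequality for s even vertices says about the walk.
Expands : (k β s : ℕ) (E O : ℕ → ℕ) → Set
Expands k β s E O = ∀ a c → a ≤ k + β + β → c ≤ k + β + β →
                    E a + s ≤ E (c + k) → s + suc (O (a + k)) ≤ k + O c

mono : (f : ℕ → ℕ) → (∀ x → f x ≤ f (suc x)) → ∀ {x y} → x ≤ y → f x ≤ f y
mono f step {x} x≤y with m≤n⇒∃[o]m+o≡n x≤y
... | d , refl = go d
  where
  go : ∀ d → f x ≤ f (x + d)
  go zero    rewrite +-identityʳ x = ≤-refl
  go (suc d) rewrite +-suc x d = ≤-trans (go d) (step (x + d))

module _ {k β E O} (w : Walk k β E O) where
  open Walk w

  private
    P = k + β + β

  shift : ∀ {a} → a ≤ P → a + k ≤ P + k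
  shift = +-monoˡ-≤ k

  within : ∀ {a} → a ≤ P → a ≤ P + k
  within a≤ = ≤-trans a≤ (m≤m+n P k)

  module _ {s} (expands : Expands k β s E O) where

    -- In terms of h x = E x + E (x + k) - x this says h c < h a.
    descend : ∀ a c → a ≤ P → c ≤ P → E (c + k) ≡ E a + s →
              suc (a + (E c + E (c + k))) ≤ c + (E a + E (a + k))
    descend a c a≤ c≤ eq = ≤-from
      (expands a c a≤ c≤ (≤-reflexive (sym eq)) +≤ ≤-reflexive eq +≤
       ≤-reflexive (sym (total (a + k) (shift a≤))) +≤ ≤-reflexive (total c (within c≤)))
      (solve 10 (λ a c k s Ea Ec Eck Eak Oc Oak →
        (Κ 1 ⊕ (a ⊕ (Ec ⊕ Eck)) ⊕ (k ⊕ Oc ⊕ (Ea ⊕ s ⊕ (Eak ⊕ Oak ⊕ c))))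
        ⊜ (c ⊕ (Ea ⊕ Eak) ⊕ (s ⊕ (Κ 1 ⊕ Oak) ⊕ (Eck ⊕ (a ⊕ k ⊕ (Ec ⊕ Oc)))))) refl
        a c k s (E a) (E c) (E (c + k)) (E (a + k)) (O c) (O (a + k)))

    windows-avoid : ∀ a → a ≤ P → E (a + k) ≢ E a + s
    windows-avoid a a≤ eq = <-irrefl refl (descend a a a≤ a≤ eq)

    -- Shifting a window by one label changes its number of even vertices by at most one, so a count
    -- above `s` could sink only by taking the value `s`, which `windows-avoid` forbids. Together
    -- with `rich-backward` this reaches every window by way of the one at 0.
    rich-forward : ∀ a d → d + a ≤ P → E a + s < E (a + k) → E (d + a) + s < E (d + a + k)
    rich-forward a zero    _ rich = rich
    rich-forward a (suc d) ≤P rich = ≤∧≢⇒<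
      (≤-from (rich-forward a d (<⇒≤ ≤P) rich +≤ E-step (d + a) +≤ E-mono (d + a + k))
        (solve 5 (λ s E₀ E₁ F₀ F₁ →
          (E₁ ⊕ s ⊕ (F₀ ⊕ (Κ 1 ⊕ E₀ ⊕ F₁)))
          ⊜ (F₁ ⊕ (Κ 1 ⊕ (E₀ ⊕ s) ⊕ (E₁ ⊕ F₀)))) refl
          s (E (d + a)) (E (suc d + a)) (E (d + a + k)) (E (suc d + a + k))))
      (λ eq → windows-avoid (suc d + a) ≤P (sym eq))

    rich-backward : ∀ a d → d + a ≤ P → E (d + a) + s < E (d + a + k) → E a + s < E (a + k)
    rich-backward a zero    _ rich = rich
    rich-backward a (suc d) ≤P rich = rich-backward a d (<⇒≤ ≤P) (≤∧≢⇒<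
      (≤-from (rich +≤ E-mono (d + a) +≤ E-step (d + a + k))
        (solve 5 (λ s E₀ E₁ F₀ F₁ →
          (E₀ ⊕ s ⊕ (F₁ ⊕ (E₁ ⊕ (Κ 1 ⊕ F₀))))
          ⊜ (F₀ ⊕ (Κ 1 ⊕ (E₁ ⊕ s) ⊕ (E₀ ⊕ F₁)))) refl
          s (E (d + a)) (E (suc d + a)) (E (d + a + k)) (E (suc d + a + k))))
      (λ eq → windows-avoid (d + a) (<⇒≤ ≤P) (sym eq)))

    rich-everywhere : ∀ m a → m ≤ P → a ≤ P → E m + s < E (m + k) → E a + s < E (a + k)
    rich-everywhere m a m≤ a≤ rich = subst (λ x → E x + s < E (x + k)) (+-identityʳ a)
      (rich-at a a≤)
      where
      at-0 : E 0 + s < E (0 + k)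
      at-0 = rich-backward 0 m (subst (_≤ P) (sym (+-identityʳ m)) m≤)
               (subst (λ x → E x + s < E (x + k)) (sym (+-identityʳ m)) rich)
      rich-at : ∀ a → a ≤ P → E (a + 0) + s < E (a + 0 + k)
      rich-at a a≤ = rich-forward 0 a (subst (_≤ P) (sym (+-identityʳ a)) a≤) at-0

-- Let `P` be the start of the last window. Richness there gives E P < t′ + β, so O P > t + β. Let h
-- x = O x + O (x + k) - x be minimal at `a` on [0, 2β]. Expansion then forbids O (c + k) = O a + t
-- for `c` from `a` to 2β, hence O P < O a + t and O a > β. As E (a + k) ≤ E P, also O (a + k) > a +
-- t - β, so h a > t. But h 0 = O k < t′ ≤ t.
always-rich-absurd : ∀ {k β E O} (w : Walk k β E O) {t t′} → t + t′ ≡ k → t′ ≤ t →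
                     Expands k β t O E →
                     (∀ a → a ≤ k + β + β → E a + t < E (a + k)) → ⊥
always-rich-absurd {k} {β} {E} {O} w {t} {t′} refl t′≤t expands rich
  -- The summand `β + β ∸ a` stands for - a, shifted to stay a natural number.
  with argmin (λ a → O a + O (a + k) + (β + β ∸ a)) (β + β)
... | a , a≤ , least = n≮n 0 (≤-from
      (O-increase +≤ E-late +≤ total-late +≤ least-at-0 +≤ E-first +≤ O₀≤0 +≤
       ≤-reflexive (total k (m≤n+m k P)) +≤ ≤-reflexive (sym (total (a + k) (shift w a≤P))) +≤
       -- The estimates clash with three units to spare; `z≤n {3}` absorbs these so that an exact
       -- identity remains.
       mono E E-mono (+-monoˡ-≤ k a≤) +≤ E-late +≤ t′≤t +≤ z≤n {3})
      (solve 12 (λ a t t′ β Oa O₀ Ok Oak Ol Ek Eak El →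
        (Κ 1 ⊕ (Oa ⊕ t ⊕ (t ⊕ t′ ⊕ β ⊕ (El ⊕ Ol ⊕ (O₀ ⊕ Ok ⊕ (β ⊕ β) ⊕ a ⊕ (Ek ⊕ (Κ 0 ⊕ (t ⊕ t′ ⊕ (Eak ⊕ Oak ⊕ (El ⊕ (t ⊕ t′ ⊕ β ⊕ (t ⊕ Κ 3))))))))))))
        ⊜ (Κ 0 ⊕ (Κ 1 ⊕ Ol ⊕ (Κ 1 ⊕ (El ⊕ t) ⊕ (β ⊕ β ⊕ (t ⊕ t′) ⊕ (Oa ⊕ Oak ⊕ (β ⊕ β) ⊕ (Κ 1 ⊕ t ⊕ (O₀ ⊕ (Ek ⊕ Ok ⊕ (a ⊕ (t ⊕ t′) ⊕ (Eak ⊕ (Κ 1 ⊕ (El ⊕ t) ⊕ (t′ ⊕ Κ 0))))))))))))) refl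
        a t t′ β (O a) (O 0) (O k) (O (a + k)) (O (β + β + k)) (E k) (E (a + k)) (E (β + β + k))))
  where
  open Walk w
  P = k + β + β
  2β+k≡P : β + β + k ≡ P
  2β+k≡P = trans (+-comm (β + β) k) (sym (+-assoc k β β))
  2β≤P : β + β ≤ P
  2β≤P = subst (β + β ≤_) 2β+k≡P (m≤m+n (β + β) k)
  a≤P : a ≤ P
  a≤P = ≤-trans a≤ 2β≤P
  least-at-0 : O a + O (a + k) + (β + β) ≤ O 0 + O k + (β + β) + a
  least-at-0 = ≤-from (least 0 z≤n +≤ ≤-reflexive (sym (m∸n+n≡m a≤)))
    (solve 7 (λ a β d Oa Oak O₀ Ok →
      (Oa ⊕ Oak ⊕ (β ⊕ β) ⊕ (O₀ ⊕ Ok ⊕ (β ⊕ β) ⊕ (d ⊕ a)))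
      ⊜ (O₀ ⊕ Ok ⊕ (β ⊕ β) ⊕ a ⊕ (Oa ⊕ Oak ⊕ d ⊕ (β ⊕ β)))) refl
      a β (β + β ∸ a) (O a) (O (a + k)) (O 0) (O k))
  avoid : ∀ c → a ≤ c → c ≤ (β + β ∸ a) + a → O (c + k) ≢ O a + t
  avoid c _ c≤′ eq = n≮n 0 (≤-from
    (descend (swap w) expands a c a≤P (≤-trans c≤ 2β≤P) eq +≤ least c c≤ +≤
     ≤-reflexive (sym (m∸n+n≡m a≤)) +≤ ≤-reflexive (m∸n+n≡m c≤))
    (solve 9 (λ a b c da dc Fa Fak Fc Fck →
      (Κ 1 ⊕ (c ⊕ (Fa ⊕ Fak) ⊕ (Fc ⊕ Fck ⊕ dc ⊕ (da ⊕ a ⊕ (b ⊕ b)))))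
      ⊜ (Κ 0 ⊕ (Κ 1 ⊕ (a ⊕ (Fc ⊕ Fck)) ⊕ (Fa ⊕ Fak ⊕ da ⊕ (b ⊕ b ⊕ (dc ⊕ c)))))) refl
      a β c (β + β ∸ a) (β + β ∸ c) (O a) (O (a + k)) (O c) (O (c + k))))
    where
    c≤ : c ≤ β + β
    c≤ = subst (c ≤_) (m∸n+n≡m a≤) c≤′
  O-increase : O (β + β + k) < O a + t
  O-increase = subst (λ x → O (x + k) < O a + t) (m∸n+n≡m a≤)
    (skips (λ x → O (x + k)) (O a + t) a (β + β ∸ a) (λ x → O-step (x + k)) avoid
      -- The start for `skips`: a window with more than `t` even vertices has fewer than `t′`, hence
      -- at most `t`, odd ones.
      (≤-from
        (rich a a≤P +≤ ≤-reflexive (total (a + k) (shift w a≤P)) +≤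
         ≤-reflexive (sym (total a (within w a≤P))) +≤ t′≤t +≤ z≤n {1})
        (solve 7 (λ a t t′ Ea Eak Oa Oak →
          (Oak ⊕ (Eak ⊕ (a ⊕ (t ⊕ t′) ⊕ (Ea ⊕ Oa ⊕ (t ⊕ Κ 1)))))
          ⊜ (Oa ⊕ t ⊕ (Κ 1 ⊕ (Ea ⊕ t) ⊕ (Eak ⊕ Oak ⊕ (a ⊕ (t′ ⊕ Κ 0)))))) refl
          a t t′ (E a) (E (a + k)) (O a) (O (a + k)))))
  E-late : E (β + β + k) + t < k + β
  E-late = subst (λ x → E x + t < k + β) (sym 2β+k≡P)
             (subst (E P + t <_) E-end (rich P ≤-refl))
  total-late : β + β + k ≤ E (β + β + k) + O (β + β + k)
  total-late = ≤-reflexive (sym (total (β + β + k) (within w (≤-reflexive 2β+k≡P))))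
  E-first : t < E k
  E-first = ≤-trans (s≤s (m≤n+m t (E 0))) (rich 0 z≤n)
  O₀≤0 : O 0 ≤ 0
  O₀≤0 = ≤-trans (m≤n+m (O 0) (E 0)) (≤-reflexive (total 0 z≤n))

walk-absurd : ∀ {k β E O} (w : Walk k β E O) {t t′} → t + t′ ≡ k → t′ ≤ t → t ≤ t′ + suc β →
              Expands k β t E O → Expands k β t′ E O → Expands k β t O E → ⊥
walk-absurd {k} {β} {E} {O} w {t} {t′} t+t′ t′≤t t≤ exp-t exp-t′ exp-tᵒ
  with argmin (λ a → E a + E (a + k) + (k + β + β ∸ a)) (k + β + β)
... | m , m≤ , least = by-cases
  where
  open Walk w
  P = k + β + β
  avoid : ∀ s → Expands k β s E O → ∀ c → c ≤ P → E (c + k) ≢ E m + s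
  avoid s exp c c≤ eq = n≮n 0 (≤-from
    (descend w exp m c m≤ c≤ eq +≤ least c c≤ +≤
     ≤-reflexive (sym (m∸n+n≡m m≤)) +≤ ≤-reflexive (m∸n+n≡m c≤))
    (solve 10 (λ k a b c da dc Fa Fak Fc Fck →
      (Κ 1 ⊕ (c ⊕ (Fa ⊕ Fak) ⊕ (Fc ⊕ Fck ⊕ dc ⊕ (da ⊕ a ⊕ (k ⊕ b ⊕ b)))))
      ⊜ (Κ 0 ⊕ (Κ 1 ⊕ (a ⊕ (Fc ⊕ Fck)) ⊕ (Fa ⊕ Fak ⊕ da ⊕ (k ⊕ b ⊕ b ⊕ (dc ⊕ c)))))) refl
      k m β c (k + β + β ∸ m) (k + β + β ∸ c) (E m) (E (m + k)) (E c) (E (c + k))))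
  -- From `E k` to its final value `k + β` the count never equals `E m + s`, so if it starts below
  -- it also ends below.
  beyond : ∀ s → Expands k β s E O → E k ≤ E m + s → k + β < E m + s
  beyond s exp below = subst (_< E m + s) E-end
    (subst (λ x → E (x + k) < E m + s) (+-identityʳ P)
      (skips (λ x → E (x + k)) (E m + s) 0 P (λ x → E-step (x + k))
        (λ c _ c≤ → avoid s exp c (subst (c ≤_) (+-identityʳ P) c≤)) below))
  E≤k : E k ≤ k
  E≤k = ≤-trans (m≤m+n (E k) (O k)) (≤-reflexive (total k (m≤n+m k P)))
  E-top : E (m + k) ≤ k + β
  E-top = subst (E (m + k) ≤_) E-end (mono E E-mono (shift w m≤))
  by-cases : ⊥
  by-cases with E k ≤? E m + t
  -- Since `E k` is at most `E (m + k)`, the window at `m` holds more than `t` even vertices.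
  ... | no early-rich = always-rich-absurd w t+t′ t′≤t exp-tᵒ
    (λ a a≤ → rich-everywhere w exp-t m a m≤ a≤
      (≤-trans (≰⇒> early-rich) (mono E E-mono (m≤n+m k m))))
  ... | yes below-t with E k ≤? E m + t′
  -- Here E m + t exceeds k + β while E m + t′ is below k, so the sizes would differ by more than
  -- `suc β`.
  ...   | no above-t′ = n≮n 0 (≤-from
    (beyond t exp-t below-t +≤ ≰⇒> above-t′ +≤ E≤k +≤ t≤)
    (solve 6 (λ k β t t′ Em Ek →
      (Κ 1 ⊕ (Em ⊕ t ⊕ (Ek ⊕ (k ⊕ (t′ ⊕ (Κ 1 ⊕ β))))))
      ⊜ (Κ 0 ⊕ (Κ 1 ⊕ (k ⊕ β) ⊕ (Κ 1 ⊕ (Em ⊕ t′) ⊕ (Ek ⊕ t))))) refl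
      k β t t′ (E m) (E k)))
  -- Now E m + t′ exceeds the number k + β of all even vertices, so the window at `m` has fewer than
  -- `t′` of them and more than `t` odd ones.
  ...   | yes below-t′ = always-rich-absurd (swap w) t+t′ t′≤t exp-t
    (λ a a≤ → rich-everywhere (swap w) exp-tᵒ m a m≤ a≤
      (≤-from
        (beyond t′ exp-t′ below-t′ +≤ E-top +≤ ≤-reflexive (sym (total (m + k) (shift w m≤))) +≤
         ≤-reflexive (total m (within w m≤)) +≤ ≤-reflexive t+t′)
        (solve 9 (λ k β m t t′ Em Emk Om Omk →
          (Κ 1 ⊕ (Om ⊕ t) ⊕ (Em ⊕ t′ ⊕ (k ⊕ β ⊕ (Emk ⊕ Omk ⊕ (m ⊕ k)))))
          ⊜ (Omk ⊕ (Κ 1 ⊕ (k ⊕ β) ⊕ (Emk ⊕ (m ⊕ k ⊕ (Em ⊕ Om ⊕ (t ⊕ t′))))))) refl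
          k β m t t′ (E m) (E (m + k)) (O m) (O (m + k)))))

-- Binomial coefficients

-- The number of vertices of weight below r.
ball : ℕ → ℕ → ℕ
ball n       zero    = 0
ball zero    (suc r) = 1
ball (suc n) (suc r) = ball n (suc r) + ball n r

ball-step : ∀ n r → ball n r ≤ ball n (suc r)
ball-step n       zero    = z≤n
ball-step zero    (suc r) = ≤-refl
ball-step (suc n) (suc r) = +-mono-≤ (ball-step n (suc r)) (ball-step n r)

ball-mono : ∀ n {r s} → r ≤ s → ball n r ≤ ball n s
ball-mono n {r} {s} r≤s with m≤n⇒m<n∨m≡n r≤s
... | inj₂ refl = ≤-refl
... | inj₁ (s≤s r≤s′) = ≤-trans (ball-mono n r≤s′) (ball-step n _)

2^suc : ∀ n → 2 ^ suc n ≡ 2 ^ n + 2 ^ n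
2^suc n = cong (2 ^ n +_) (+-identityʳ (2 ^ n))

ball≤2^n : ∀ n r → ball n r ≤ 2 ^ n
ball≤2^n n       zero    = z≤n
ball≤2^n zero    (suc r) = ≤-refl
ball≤2^n (suc n) (suc r) = subst (ball n (suc r) + ball n r ≤_) (sym (2^suc n))
  (+-mono-≤ (ball≤2^n n (suc r)) (ball≤2^n n r))

ball-full : ∀ {n r} → n < r → ball n r ≡ 2 ^ n
ball-full {zero}  (s≤s _) = refl
ball-full {suc n} (s≤s n<r) =
  trans (cong₂ _+_ (ball-full (m≤n⇒m≤1+n n<r)) (ball-full n<r)) (sym (2^suc n))

-- Complementing every coordinate takes the vertices of weight below `s` to those of weight at least
-- `r`. The induction is Pascal's recursion with the four summands paired crosswise.
ball-complement : ∀ n r s → r + s ≡ suc n → ball n r + ball n s ≡ 2 ^ n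
ball-complement n       zero    (suc s) refl = ball-full {n} ≤-refl
ball-complement n       (suc r) zero    eq   =
  trans (+-identityʳ _) (ball-full {n} (≤-reflexive (sym (trans (sym (+-identityʳ _)) eq))))
ball-complement zero    (suc r) (suc s) eq rewrite +-suc r s = contradiction eq λ ()
ball-complement (suc n) (suc r) (suc s) eq = begin
  ball n (suc r) + ball n r + (ball n (suc s) + ball n s)
    ≡⟨ regroup (ball n (suc r)) (ball n r) (ball n (suc s)) (ball n s) ⟩
  ball n (suc r) + ball n s + (ball n r + ball n (suc s))
    ≡⟨ cong₂ _+_ (ball-complement n (suc r) s (trans (sym (+-suc r s)) (suc-injective eq)))
                 (ball-complement n r (suc s) (suc-injective eq)) ⟩
  2 ^ n + 2 ^ n
    ≡⟨ 2^suc n ⟨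
  2 ^ suc n ∎
  where
  open ≡-Reasoning
  regroup : ∀ a b c d → a + b + (c + d) ≡ a + d + (b + c)
  regroup = solve-∀

ball-C : ∀ n r → ball n (suc r) ≡ ball n r + n C r
ball-C zero    zero    = refl
ball-C zero    (suc r) = refl
ball-C (suc n) zero    = trans (+-identityʳ _) (ball-C n zero)
ball-C (suc n) (suc r) = begin
  ball n (suc (suc r)) + ball n (suc r)
    ≡⟨ cong₂ _+_ (ball-C n (suc r)) (ball-C n r) ⟩
  ball n (suc r) + n C suc r + (ball n r + n C r)
    ≡⟨ regroup (ball n (suc r)) (n C suc r) (ball n r) (n C r) ⟩
  ball n (suc r) + ball n r + (n C r + n C suc r)
    ≡⟨ cong (ball n (suc r) + ball n r +_) (nCk+nC[k+1]≡[n+1]C[k+1] n r) ⟩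
  ball n (suc r) + ball n r + suc n C suc r ∎
  where
  open ≡-Reasoning
  regroup : ∀ a b c d → a + b + (c + d) ≡ a + c + (d + b)
  regroup = solve-∀

double : ℕ → ℕ
double zero    = zero
double (suc h) = suc (suc (double h))

double≡ : ∀ h → double h ≡ h + h
double≡ zero    = refl
double≡ (suc h) = cong suc (trans (cong suc (double≡ h)) (sym (+-suc h h)))

data Parity : ℕ → Set where
  even : ∀ h → Parity (double h)
  odd  : ∀ h → Parity (suc (double h))

parity : ∀ n → Parity n
parity zero = even 0
parity (suc n) with parity n
... | even h = odd h
... | odd h  = even (suc h)

[2+n]/2 : ∀ n → suc (suc n) / 2 ≡ suc (n / 2)
[2+n]/2 n = m/n≡1+[m∸n]/n {suc (suc n)} {2} (s≤s (s≤s z≤n))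

double/2 : ∀ h → double h / 2 ≡ h
double/2 zero    = refl
double/2 (suc h) = trans ([2+n]/2 (double h)) (cong suc (double/2 h))

1+double/2 : ∀ h → suc (double h) / 2 ≡ h
1+double/2 zero    = refl
1+double/2 (suc h) = trans ([2+n]/2 (suc (double h))) (cong suc (1+double/2 h))

-- By Pascal's rule the claim for `suc n` and `suc r` comes down to n C r ≤ n C (r + 2): two rising
-- steps or, when n = 2r + 2, the symmetry of the row.
C-rising : ∀ n r → suc (r + r) ≤ n → n C r ≤ n C suc r
C-rising (suc n) zero    _ =
  subst (suc n C 0 ≤_) (nCk+nC[k+1]≡[n+1]C[k+1] n 0) (m≤m+n 1 (n C 1))
C-rising (suc n) (suc r) (s≤s 2r+2≤n) =
  subst₂ _≤_ (trans (+-comm (n C suc r) (n C r)) (nCk+nC[k+1]≡[n+1]C[k+1] n r))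
             (nCk+nC[k+1]≡[n+1]C[k+1] n (suc r))
             (+-monoʳ-≤ (n C suc r) two-steps)
  where
  2r+2 : suc r + suc r ≡ suc (suc (r + r))
  2r+2 = cong suc (+-suc r r)
  two-steps : n C r ≤ n C suc (suc r)
  two-steps with m≤n⇒m<n∨m≡n (subst (_≤ n) 2r+2 2r+2≤n)
  ... | inj₁ 2r+3≤n = ≤-trans (C-rising n r (<⇒≤ (<⇒≤ 2r+3≤n)))
                        (C-rising n (suc r) (subst (_≤ n) (cong suc (sym 2r+2)) 2r+3≤n))
  ... | inj₂ refl = ≤-reflexive (trans (nCk≡nC[n∸k] {r} (m≤n⇒m≤1+n (m≤n⇒m≤1+n (m≤m+n r r))))
                      (cong (n C_) (trans (cong (_∸ r) (cong suc (sym (+-suc r r))))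
                         (trans (cong (_∸ r) (sym (+-suc r (suc r)))) (m+n∸m≡n r (suc (suc r)))))))

C-rising-to : ∀ n r d → (d + r) + (d + r) ≤ n + 1 → n C r ≤ n C (d + r)
C-rising-to n r zero    _ = ≤-refl
C-rising-to n r (suc d) p = ≤-trans (C-rising-to n r d (≤-trans (+-mono-≤ (n≤1+n (d + r)) (n≤1+n (d + r))) p))
                                    (C-rising n (d + r) (≤-from p
      (solve 2 (λ n x →
        (Κ 1 ⊕ (x ⊕ x) ⊕ (n ⊕ Κ 1))
        ⊜ (n ⊕ (Κ 1 ⊕ x ⊕ (Κ 1 ⊕ x)))) refl
        n (d + r))))

half≤ : ∀ {n} → Parity n → n / 2 + n / 2 ≤ n
half≤ (even h) rewrite double/2 h = ≤-reflexive (sym (double≡ h))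
half≤ (odd h)  rewrite 1+double/2 h = m≤n⇒m≤1+n (≤-reflexive (sym (double≡ h)))

n≤half : ∀ {n} → Parity n → n ≤ n / 2 + n / 2 + 1
n≤half (even h) rewrite double/2 h = ≤-trans (≤-reflexive (double≡ h)) (m≤m+n (h + h) 1)
n≤half (odd h)  rewrite 1+double/2 h = ≤-reflexive (trans (cong suc (double≡ h)) (+-comm 1 (h + h)))

C≤central : ∀ n r → n C r ≤ n C (n / 2)
C≤central n r with r ≤? n / 2
... | yes r≤ = subst (λ s → n C r ≤ n C s) (m∸n+n≡m r≤)
                 (C-rising-to n r (n / 2 ∸ r)
                   (subst (λ s → s + s ≤ n + 1) (sym (m∸n+n≡m r≤)) (≤-trans (half≤ (parity n)) (m≤m+n n 1))))
... | no r≰ with r ≤? n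
...   | no r>n = subst (_≤ n C (n / 2)) (sym (k>n⇒nCk≡0 (≰⇒> r>n))) z≤n
-- Past the middle, `r` is first reflected to `n ∸ r`.
...   | yes r≤n = subst₂ (λ x s → x ≤ n C s) (sym (nCk≡nC[n∸k] r≤n)) (m∸n+n≡m below)
                   (C-rising-to n (n ∸ r) (n / 2 ∸ (n ∸ r))
                     (subst (λ s → s + s ≤ n + 1) (sym (m∸n+n≡m below)) (≤-trans (half≤ (parity n)) (m≤m+n n 1))))
  where
  below : n ∸ r ≤ n / 2
  below = +-cancelʳ-≤ r _ _ (≤-from
    (≤-reflexive (m∸n+n≡m r≤n) +≤ n≤half (parity n) +≤ ≰⇒> r≰)
    (solve 4 (λ n r d h →
      (d ⊕ r ⊕ (n ⊕ (h ⊕ h ⊕ Κ 1 ⊕ r)))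
      ⊜ (h ⊕ r ⊕ (d ⊕ r ⊕ (n ⊕ (Κ 1 ⊕ h))))) refl
      n r (n ∸ r) (n / 2)))

-- The simplicial order

bit : Bool → ℕ
bit true  = 1
bit false = 0

weight : ∀ {n} → Vertex n → ℕ
weight []      = 0
weight (b ∷ v) = bit b + weight v

-- The rank of v in the simplicial order: by weight, and within a weight the vertex that has the
-- coordinate true at the first difference comes first.
pos : ∀ {n} → Vertex n → ℕ
pos []              = 0
pos {suc n} (b ∷ v) = pos v + ball n (bit b + weight v)

-- Each weight occupies one block of ranks, bounded here and in `pos<ball`; the rank therefore
-- compares weights first.
ball≤pos : ∀ {n} (v : Vertex n) → ball n (weight v) ≤ pos v
ball≤pos []                  = z≤n
ball≤pos {suc n} (true  ∷ v) = ≤-trans (≤-reflexive (+-comm (ball n (suc (weight v))) _)) (+-monoˡ-≤ _ (ball≤pos v))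
ball≤pos {suc n} (false ∷ v) with weight v | ball≤pos v
... | zero  | _ = z≤n
... | suc r | p = +-mono-≤ p (ball-step n r)

pos<ball : ∀ {n} (v : Vertex n) → pos v < ball n (suc (weight v))
pos<ball []                  = s≤s z≤n
pos<ball {suc n} (true  ∷ v) = +-monoˡ-< _ (≤-trans (pos<ball v) (ball-step n (suc (weight v))))
pos<ball {suc n} (false ∷ v) = +-monoˡ-< _ (pos<ball v)

pos<2^n : ∀ {n} (v : Vertex n) → pos v < 2 ^ n
pos<2^n {n} v = ≤-trans (pos<ball v) (ball≤2^n n (suc (weight v)))

weight<⇒pos< : ∀ {n} {v w : Vertex n} → weight v < weight w → pos v < pos w
weight<⇒pos< {n} {v} {w} lt =
  ≤-trans (pos<ball v) (≤-trans (ball-mono n lt) (ball≤pos w))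

pos≤⇒weight≤ : ∀ {n} {v w : Vertex n} → pos v ≤ pos w → weight v ≤ weight w
pos≤⇒weight≤ {v = v} {w} le with weight v ≤? weight w
... | yes p = p
... | no ¬p = contradiction (weight<⇒pos< {v = w} {v} (≰⇒> ¬p)) (≤⇒≯ le)

bit-injective : ∀ a b → bit a ≡ bit b → a ≡ b
bit-injective true  true  _ = refl
bit-injective false false _ = refl

-- Equal ranks force equal weights, so the `ball` summands cancel and the tails agree by induction;
-- the weights then determine the heads.
pos-injective : ∀ {n} {v w : Vertex n} → pos v ≡ pos w → v ≡ w
pos-injective {v = []} {[]} _ = refl
pos-injective {suc n} {b ∷ v} {c ∷ w} eq = cong₂ _∷_ b≡c v≡w
  where
  same-weight : bit b + weight v ≡ bit c + weight w
  same-weight = ≤-antisym (pos≤⇒weight≤ {v = b ∷ v} {c ∷ w} (≤-reflexive eq))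
                          (pos≤⇒weight≤ {v = c ∷ w} {b ∷ v} (≤-reflexive (sym eq)))
  v≡w : v ≡ w
  v≡w = pos-injective (+-cancelʳ-≡ (ball n (bit b + weight v)) (pos v) (pos w)
          (trans eq (cong (λ r → pos w + ball n r) (sym same-weight))))
  b≡c : b ≡ c
  b≡c = bit-injective b c (+-cancelʳ-≡ (weight v) (bit b) (bit c)
          (trans same-weight (cong (λ u → bit c + weight u) (sym v≡w))))

pos-cons-≤ : ∀ {n} b {v w : Vertex n} → pos v ≤ pos w → pos (b ∷ v) ≤ pos (b ∷ w)
pos-cons-≤ {n} b {v} {w} le =
  +-mono-≤ le (ball-mono n (+-monoʳ-≤ (bit b) (pos≤⇒weight≤ {v = v} {w} le)))

weight-insertAt : ∀ {n} (v : Vertex n) i b → weight (insertAt v i b) ≡ bit b + weight v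
weight-insertAt v       zero    b = refl
weight-insertAt (c ∷ v) (suc i) b = trans (cong (bit c +_) (weight-insertAt v i b))
  (trans (sym (+-assoc (bit c) (bit b) _)) (trans (cong (_+ weight v) (+-comm (bit c) (bit b)))
    (+-assoc (bit b) (bit c) _)))

weight-lex : ∀ {n} {v w : Vertex n} → pos v < pos w → weight v < weight w ⊎ weight v ≡ weight w
weight-lex {v = v} {w} lt = m≤n⇒m<n∨m≡n (pos≤⇒weight≤ {v = v} {w} (<⇒≤ lt))

-- Inserting the same bit raises both weights equally and does not affect which vertex has `true` at
-- the first difference. Hence a facet inherits the order of the smaller cube, on which compressions
-- rely.
pos-insertAt : ∀ {n} {v w : Vertex n} i b → pos v < pos w → pos (insertAt v i b) < pos (insertAt w i b)
pos-insertAt {n} {v} {w} zero b lt =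
  +-mono-<-≤ lt (ball-mono n (+-monoʳ-≤ (bit b) (pos≤⇒weight≤ {v = v} {w} (<⇒≤ lt))))
pos-insertAt {suc n} {c ∷ v} {d ∷ w} (suc i) b lt with weight-lex {v = c ∷ v} {d ∷ w} lt
... | inj₁ lighter = weight<⇒pos< {v = c ∷ insertAt v i b} {d ∷ insertAt w i b}
  (subst₂ _<_ (sym (weight-insertAt (c ∷ v) (suc i) b)) (sym (weight-insertAt (d ∷ w) (suc i) b))
    (+-monoʳ-< (bit b) lighter))
... | inj₂ same = +-mono-<-≤
  (pos-insertAt i b (+-cancelʳ-< (ball n (bit c + weight v)) (pos v) (pos w)
    (subst (λ r → pos v + ball n (bit c + weight v) < pos w + ball n r) (sym same) lt)))
  (≤-reflexive (cong (ball (suc n)) (trans (weight-insertAt (c ∷ v) (suc i) b)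
    (trans (cong (bit b +_) same) (sym (weight-insertAt (d ∷ w) (suc i) b))))))

-- Deleting the last true coordinate gives the earliest vertex of the closed neighbourhood.
first : ∀ {n} → Vertex n → Vertex n
first []      = []
first (b ∷ v) with weight v
... | zero  = false ∷ v
... | suc _ = b ∷ first v

weight0⇒pos0 : ∀ {n} (v : Vertex n) → weight v ≡ 0 → pos v ≡ 0
weight0⇒pos0 []          _  = refl
weight0⇒pos0 {suc n} (false ∷ v) eq = cong₂ _+_ (weight0⇒pos0 v eq) (cong (ball n) eq)

weight-first : ∀ {n} (v : Vertex n) {r} → weight v ≡ suc r → weight (first v) ≡ r
weight-first (b ∷ v) eq with weight v in wv
weight-first (true  ∷ v) refl | zero  = wv
weight-first (b     ∷ v) eq   | suc r =
  suc-injective (trans (sym (+-suc (bit b) (weight (first v))))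
    (trans (cong (λ x → bit b + suc x) (weight-first v wv)) eq))

first-cases : ∀ {n} (b : Bool) (v : Vertex n) →
              (weight v ≡ 0 × first (b ∷ v) ≡ false ∷ v) ⊎
              (∃ λ r → weight v ≡ suc r × first (b ∷ v) ≡ b ∷ first v)
first-cases b v with weight v
... | zero  = inj₁ (refl , refl)
... | suc r = inj₂ (r , refl , refl)

first-heavy : ∀ {n} (b : Bool) (v : Vertex n) {r} → weight v ≡ suc r → first (b ∷ v) ≡ b ∷ first v
first-heavy b v wv rewrite wv = refl

pos-first-light : ∀ {n} (b : Bool) (v : Vertex n) → weight v ≡ 0 → pos (first (b ∷ v)) ≡ 0
pos-first-light b v wv rewrite wv = weight0⇒pos0 (false ∷ v) wv

first≤ : ∀ {n} (v : Vertex n) → pos (first v) ≤ pos v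
first≤ []      = z≤n
first≤ (b ∷ v) with first-cases b v
... | inj₁ (wv , _)     = ≤-trans (≤-reflexive (pos-first-light b v wv)) z≤n
... | inj₂ (r , wv , eq) rewrite eq = pos-cons-≤ b {first v} {v} (first≤ v)

hamming0⇒≡ : ∀ {n} {u v : Vertex n} → hamming u v ≤ 0 → u ≡ v
hamming0⇒≡ {u = []}        {[]}        _ = refl
hamming0⇒≡ {u = true  ∷ u} {true  ∷ v} p = cong (true ∷_) (hamming0⇒≡ p)
hamming0⇒≡ {u = false ∷ u} {false ∷ v} p = cong (false ∷_) (hamming0⇒≡ p)

first-least : ∀ {n} {u v : Vertex n} → hamming u v ≤ 1 → pos (first v) ≤ pos u
first-least {u = []} {[]} _ = z≤n
first-least {suc n} {b ∷ u} {c ∷ v} near with first-cases c v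
... | inj₁ (wv , _) = ≤-trans (≤-reflexive (pos-first-light c v wv)) z≤n
... | inj₂ (r , wv , eq) rewrite eq = go b c near
  where
  go : ∀ b c → hamming (b ∷ u) (c ∷ v) ≤ 1 → pos (c ∷ first v) ≤ pos (b ∷ u)
  go true  true  p = pos-cons-≤ true  {first v} {u} (first-least {u = u} {v} p)
  go false false p = pos-cons-≤ false {first v} {u} (first-least {u = u} {v} p)
  -- Only the heads differ. Here `true ∷ first v` has the weight of `false ∷ v` and the earlier
  -- head.
  go false true  (s≤s p) with hamming0⇒≡ {u = u} {v} p
  ... | refl = +-mono-≤ (first≤ u) (ball-mono n (≤-reflexive
                 (trans (cong suc (weight-first u wv)) (sym wv))))
  go true  false (s≤s p) with hamming0⇒≡ {u = u} {v} p
  ... | refl = +-mono-≤ (first≤ u) (ball-mono n (≤-trans (pos≤⇒weight≤ {v = first u} {u} (first≤ u))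
                 (n≤1+n _)))

hamming-refl : ∀ {n} (v : Vertex n) → hamming v v ≡ 0
hamming-refl []          = refl
hamming-refl (true  ∷ v) = hamming-refl v
hamming-refl (false ∷ v) = hamming-refl v

hamming-first : ∀ {n} (v : Vertex n) → hamming (first v) v ≤ 1
hamming-first []          = z≤n
hamming-first (b ∷ v) with weight v
hamming-first (true  ∷ v) | zero  = s≤s (≤-reflexive (hamming-refl v))
hamming-first (false ∷ v) | zero  = ≤-trans (≤-reflexive (hamming-refl v)) z≤n
hamming-first (true  ∷ v) | suc _ = hamming-first v
hamming-first (false ∷ v) | suc _ = hamming-first v

-- Apart from the zero vertex, `first` lowers each weight by one; for equal weights the comparison
-- passes to the tails. This is why neighbourhoods of initial segments are initial segments
-- (`nb-Init-closed`).
first-mono : ∀ {n} {v w : Vertex n} → pos v ≤ pos w → pos (first v) ≤ pos (first w)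
first-mono {v = []} {[]} _ = z≤n
first-mono {suc n} {b ∷ v} {c ∷ w} le with m≤n⇒m<n∨m≡n (pos≤⇒weight≤ {v = b ∷ v} {c ∷ w} le)
... | inj₁ lighter = go (weight (b ∷ v)) refl
  where
  go : ∀ r → weight (b ∷ v) ≡ r → pos (first (b ∷ v)) ≤ pos (first (c ∷ w))
  go zero eq = ≤-trans (≤-trans (first≤ (b ∷ v)) (≤-reflexive (weight0⇒pos0 (b ∷ v) eq))) z≤n
  go (suc r) eq with weight (c ∷ w) in eq′
  ... | zero = contradiction lighter λ ()
  ... | suc s = <⇒≤ (weight<⇒pos< {v = first (b ∷ v)} {first (c ∷ w)}
    (subst₂ _<_ (sym (weight-first (b ∷ v) eq)) (sym (weight-first (c ∷ w) eq′))
      (≤-pred (subst (_< suc s) eq lighter))))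
... | inj₂ same = go (weight v) (weight w) refl refl
  where
  tails : pos v ≤ pos w
  tails = +-cancelʳ-≤ (ball n (bit b + weight v)) (pos v) (pos w)
    (subst (λ r → pos v + ball n (bit b + weight v) ≤ pos w + ball n r) (sym same) le)
  go : ∀ r s → weight v ≡ r → weight w ≡ s → pos (first (b ∷ v)) ≤ pos (first (c ∷ w))
  go zero    s       wv ww = ≤-trans (≤-reflexive (pos-first-light b v wv)) z≤n
  go (suc r) zero    wv ww =
    contradiction (subst₂ _≤_ wv ww (pos≤⇒weight≤ {v = v} {w} tails)) λ ()
  go (suc r) (suc s) wv ww rewrite first-heavy b v wv | first-heavy c w ww =
    +-mono-≤ (first-mono {v = v} {w} tails) (ball-mono n (≤-reflexive
      (suc-injective (trans (sym (+-suc (bit b) (weight (first v))))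
        (trans (cong (bit b +_) (trans (cong suc (weight-first v wv)) (sym wv)))
        (trans same (trans (cong (bit c +_) (trans ww (sym (cong suc (weight-first w ww)))))
          (+-suc (bit c) (weight (first w))))))))))

-- Each coordinate of v contributes one binomial coefficient to the drop pos v - pos (first v).
pos≤first+centralSum : ∀ {n} (v : Vertex n) → pos v ≤ pos (first v) + centralSum n
pos≤first+centralSum [] = z≤n
pos≤first+centralSum {suc n} (b ∷ v) with first-cases b v
... | inj₁ (wv , _) rewrite weight0⇒pos0 v wv = ≤-trans (light b) (m≤n+m _ (pos (first (b ∷ v))))
  where
  light : ∀ b → ball n (bit b + weight v) ≤ centralSum n + n C (n / 2)
  light true  rewrite wv | ball-C n 0 =
    ≤-trans (C≤central n 0) (m≤n+m _ (centralSum n))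
  light false rewrite wv = z≤n
... | inj₂ (r , wv , eq) rewrite eq | weight-first v wv | wv | +-suc (bit b) r | ball-C n (bit b + r) =
  ≤-from (pos≤first+centralSum v +≤ C≤central n (bit b + r))
    (solve 6 (λ p f s x c m →
      (p ⊕ (x ⊕ c) ⊕ (f ⊕ s ⊕ m))
      ⊜ (f ⊕ x ⊕ (s ⊕ m) ⊕ (p ⊕ c))) refl
      (pos v) (pos (first v)) (centralSum n) (ball n (bit b + r)) (n C (bit b + r)) (n C (n / 2)))

-- Two vertices with the largest possible drop whose predecessors lie symmetrically about the
-- middle of the order, at distance at most that drop.
record Critical (n a b : ℕ) : Set where
  field
    low high    : Vertex n
    weight-low  : weight low  ≡ suc a
    weight-high : weight high ≡ suc b
    drop-low    : pos (first low)  + centralSum n ≡ pos low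
    drop-high   : pos (first high) + centralSum n ≡ pos high
    symmetric   : pos (first low) + pos (first high) + suc (centralSum n) ≡ 2 ^ n
    low≤high    : pos (first low) ≤ pos (first high)
    high≤low    : pos (first high) ≤ pos (first low) + centralSum n

pos-first-cons : ∀ {n} (b : Bool) (v : Vertex n) {r} → weight v ≡ suc r →
                 pos (first (b ∷ v)) ≡ pos (first v) + ball n (bit b + r)
pos-first-cons {n} b v wv = trans (cong pos (first-heavy b v wv))
  (cong (λ x → pos (first v) + ball n (bit b + x)) (weight-first v wv))

pos-cons : ∀ {n} (b : Bool) (v : Vertex n) {r} → weight v ≡ suc r →
           pos (b ∷ v) ≡ pos v + (ball n (bit b + r) + n C (bit b + r))
pos-cons {n} b v {r} wv = cong (pos v +_) (trans
  (cong (ball n) (trans (cong (bit b +_) wv) (+-suc (bit b) r))) (ball-C n (bit b + r)))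

-- The new heads add `n C a` and `n C d` to the two drops, which stay maximal when both equal the
-- central coefficient. The conditions on `ball` carry over symmetry, order and distance.
extend : ∀ {n r s} b c → let a = bit b + r; d = bit c + s; m = n C (n / 2) in
         n C a ≡ m → n C d ≡ m → ball n a + ball n d + m ≡ 2 ^ n →
         ball n a ≤ ball n d → ball n d ≤ ball n a + m →
         Critical n r s → Critical (suc n) a d
extend {n} {r} {s} b c Ca Cd balls≡ ballsₗ ballsᵤ K = record
  { low = b ∷ low
  ; high = c ∷ high
  ; weight-low = trans (cong (bit b +_) weight-low) (+-suc (bit b) r)
  ; weight-high = trans (cong (bit c +_) weight-high) (+-suc (bit c) s)
  ; drop-low = drop b low weight-low Ca drop-low
  ; drop-high = drop c high weight-high Cd drop-high
  ; symmetric = begin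
      pos (first (b ∷ low)) + pos (first (c ∷ high)) + suc (centralSum n + m)
        ≡⟨ cong₂ (λ x y → x + y + suc (centralSum n + m)) eqₗ eqₕ ⟩
      pos (first low) + ball n (bit b + r) + (pos (first high) + ball n (bit c + s))
        + suc (centralSum n + m)
        ≡⟨ regroup (pos (first low)) (pos (first high)) (centralSum n) (ball n (bit b + r)) _ m ⟩
      pos (first low) + pos (first high) + suc (centralSum n)
        + (ball n (bit b + r) + ball n (bit c + s) + m)
        ≡⟨ cong₂ _+_ symmetric balls≡ ⟩
      2 ^ n + 2 ^ n
        ≡⟨ 2^suc n ⟨
      2 ^ suc n ∎
  ; low≤high = subst₂ _≤_ (sym eqₗ) (sym eqₕ) (+-mono-≤ low≤high ballsₗ)
  ; high≤low = subst₂ (λ x y → y ≤ x + (centralSum n + m)) (sym eqₗ) (sym eqₕ)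
      (≤-from (high≤low +≤ ballsᵤ)
        (solve 6 (λ p q u x y z →
          (q ⊕ y ⊕ (p ⊕ u ⊕ (x ⊕ z)))
          ⊜ (p ⊕ x ⊕ (u ⊕ z) ⊕ (q ⊕ y))) refl
          (pos (first low)) (pos (first high)) (centralSum n) (ball n (bit b + r)) (ball n (bit c + s)) m))
  }
  where
  open Critical K
  open ≡-Reasoning
  regroup : ∀ p q u x y z → p + x + (q + y) + suc (u + z) ≡ p + q + suc u + (x + y + z)
  regroup = solve-∀
  m = n C (n / 2)
  eqₗ : pos (first (b ∷ low)) ≡ pos (first low) + ball n (bit b + r)
  eqₗ = pos-first-cons b low weight-low
  eqₕ : pos (first (c ∷ high)) ≡ pos (first high) + ball n (bit c + s)
  eqₕ = pos-first-cons c high weight-high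
  drop : ∀ b v {r} → weight v ≡ suc r → n C (bit b + r) ≡ m →
         pos (first v) + centralSum n ≡ pos v →
         pos (first (b ∷ v)) + centralSum (suc n) ≡ pos (b ∷ v)
  drop b v {r} wv Ceq eq = begin
    pos (first (b ∷ v)) + (centralSum n + m)
      ≡⟨ cong (_+ (centralSum n + m)) (pos-first-cons b v wv) ⟩
    pos (first v) + ball n (bit b + r) + (centralSum n + m)
      ≡⟨ swap-middle (pos (first v)) (ball n (bit b + r)) (centralSum n) m ⟩
    pos (first v) + centralSum n + (ball n (bit b + r) + m)
      ≡⟨ cong₂ (λ x y → x + (ball n (bit b + r) + y)) eq (sym Ceq) ⟩
    pos v + (ball n (bit b + r) + n C (bit b + r))
      ≡⟨ pos-cons b v wv ⟨
    pos (b ∷ v) ∎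
    where
    swap-middle : ∀ a b c d → a + b + (c + d) ≡ a + c + (b + d)
    swap-middle = solve-∀

-- The heads keep `a` and `d` at central indices. An even row has one such index, where `true` on
-- `low` and `false` on `high` make the two meet; an odd row has two, which the opposite choice
-- separates again.
critical-odd  : ∀ h → Critical (suc (double h)) h h
critical-even : ∀ h → Critical (double (suc h)) h (suc h)

critical-odd zero = record
  { low = true ∷ [] ; high = true ∷ [] ; weight-low = refl ; weight-high = refl
  ; drop-low = refl ; drop-high = refl ; symmetric = refl ; low≤high = z≤n ; high≤low = z≤n }
critical-odd (suc h) = extend true false C-mid C-mid balls ≤-refl (m≤m+n _ _) (critical-even h)
  where
  n = double (suc h)
  C-mid : n C suc h ≡ n C (n / 2)
  C-mid = cong (n C_) (sym (double/2 (suc h)))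
  balls : ball n (suc h) + ball n (suc h) + n C (n / 2) ≡ 2 ^ n
  balls = trans (trans (+-assoc (ball n (suc h)) _ _)
      (cong (ball n (suc h) +_) (trans (cong (ball n (suc h) +_) (sym C-mid)) (sym (ball-C n (suc h))))))
    (ball-complement n (suc h) (suc (suc h))
      (cong suc (trans (+-suc h (suc h)) (cong suc (trans (+-suc h h) (cong suc (sym (double≡ h))))))))

critical-even h = extend false true (cong (n C_) (sym mid)) C-upper balls
    (ball-step n h)
    (≤-reflexive (trans (ball-C n h) (cong (λ x → ball n h + n C x) (sym mid)))) (critical-odd h)
  where
  n = suc (double h)
  mid : n / 2 ≡ h
  mid = 1+double/2 h
  C-upper : n C suc h ≡ n C (n / 2)
  C-upper = trans (nCk≡nC[n∸k] {suc h} {n} (s≤s (subst (h ≤_) (sym (double≡ h)) (m≤m+n h h))))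
    (cong (n C_) (trans (trans (cong (_∸ h) (double≡ h)) (m+n∸m≡n h h)) (sym mid)))
  balls : ball n h + ball n (suc h) + n C (n / 2) ≡ 2 ^ n
  balls = trans (trans (trans (+-assoc (ball n h) _ _) (trans (cong (ball n h +_) (+-comm (ball n (suc h)) _))
      (sym (+-assoc (ball n h) _ _))))
      (cong (_+ ball n (suc h)) (trans (cong (λ x → ball n h + n C x) mid) (sym (ball-C n h)))))
    (ball-complement n (suc h) (suc h) (cong suc (trans (+-suc h h) (cong suc (sym (double≡ h))))))

-- Counting vertices

sumV : ∀ {n} → (Vertex n → ℕ) → ℕ
sumV {zero}  f = f []
sumV {suc n} f = sumV (λ v → f (true ∷ v)) + sumV (λ v → f (false ∷ v))

sumV-mono : ∀ {n} {f g : Vertex n → ℕ} → (∀ v → f v ≤ g v) → sumV f ≤ sumV g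
sumV-mono {zero}  f≤g = f≤g []
sumV-mono {suc n} f≤g = +-mono-≤ (sumV-mono (λ v → f≤g (true ∷ v))) (sumV-mono (λ v → f≤g (false ∷ v)))

sumV-cong : ∀ {n} {f g : Vertex n → ℕ} → (∀ v → f v ≡ g v) → sumV f ≡ sumV g
sumV-cong f≡g = ≤-antisym (sumV-mono (≤-reflexive ∘ f≡g)) (sumV-mono (≤-reflexive ∘ sym ∘ f≡g))

sumV-strict : ∀ {n} {f g : Vertex n → ℕ} → (∀ v → f v ≤ g v) → ∀ v → f v < g v → sumV f < sumV g
sumV-strict f≤g []          lt = lt
sumV-strict f≤g (true  ∷ v) lt =
  +-mono-<-≤ (sumV-strict (λ v → f≤g (true ∷ v)) v lt) (sumV-mono (λ v → f≤g (false ∷ v)))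
sumV-strict f≤g (false ∷ v) lt =
  +-mono-≤-< (sumV-mono (λ v → f≤g (true ∷ v))) (sumV-strict (λ v → f≤g (false ∷ v)) v lt)

+-interchange : ∀ a b c d → a + b + (c + d) ≡ a + c + (b + d)
+-interchange = solve-∀

sumV-+ : ∀ {n} (f g : Vertex n → ℕ) → sumV (λ v → f v + g v) ≡ sumV f + sumV g
sumV-+ {zero}  f g = refl
sumV-+ {suc n} f g = trans (cong₂ _+_ (sumV-+ {n} _ _) (sumV-+ {n} _ _))
  (+-interchange (sumV (λ v → f (true ∷ v))) _ _ _)

sumV-1 : ∀ n → sumV {n} (λ _ → 1) ≡ 2 ^ n
sumV-1 zero    = refl
sumV-1 (suc n) = trans (cong₂ _+_ (sumV-1 n) (sumV-1 n)) (sym (2^suc n))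

sumV-insertAt : ∀ {n} (f : Vertex (suc n) → ℕ) i →
                sumV f ≡ sumV (λ v → f (insertAt v i true)) + sumV (λ v → f (insertAt v i false))
sumV-insertAt         f zero    = refl
sumV-insertAt {suc n} f (suc i) = trans
  (cong₂ _+_ (sumV-insertAt (λ v → f (true ∷ v)) i) (sumV-insertAt (λ v → f (false ∷ v)) i))
  (+-interchange (sumV (λ v → f (true ∷ insertAt v i true))) _ _ _)

≤sumV : ∀ {n} (f : Vertex n → ℕ) v → f v ≤ sumV f
≤sumV f []          = ≤-refl
≤sumV f (true  ∷ v) = ≤-trans (≤sumV (λ v → f (true ∷ v)) v) (m≤m+n _ _)
≤sumV f (false ∷ v) = ≤-trans (≤sumV (λ v → f (false ∷ v)) v) (m≤n+m _ _)

-- Vertex sets, initial segments and neighbourhoods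

VSet : ℕ → Set
VSet n = Vertex n → Bool

infix 4 _∈_ _⊆_

_∈_ : ∀ {n} → Vertex n → VSet n → Set
v ∈ A = T (A v)

_⊆_ : ∀ {n} → VSet n → VSet n → Set
A ⊆ B = ∀ v → v ∈ A → v ∈ B

_∪_ : ∀ {n} → VSet n → VSet n → VSet n
(A ∪ B) v = A v ∨ B v

count : ∀ {n} → VSet n → ℕ
count A = sumV (λ v → bit (A v))

bit-mono : ∀ {a b} → (T a → T b) → bit a ≤ bit b
bit-mono {false}         _ = z≤n
bit-mono {true}  {true}  _ = ≤-refl
bit-mono {true}  {false} f = contradiction (f tt) λ ()

bit-T : ∀ {a} → T a → 1 ≤ bit a
bit-T {true} _ = ≤-refl

count-mono : ∀ {n} {A B : VSet n} → A ⊆ B → count A ≤ count B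
count-mono A⊆B = sumV-mono (λ v → bit-mono (A⊆B v))

count≤2^n : ∀ {n} (A : VSet n) → count A ≤ 2 ^ n
count≤2^n {n} A = subst (count A ≤_) (sumV-1 n) (sumV-mono (λ v → bit-mono {A v} {true} _))

find : ∀ {n} (A : VSet n) → (∃ λ v → v ∈ A) ⊎ count A ≡ 0
find {zero} A with A [] in eq
... | true  = inj₁ ([] , subst T (sym eq) tt)
... | false = inj₂ refl
find {suc n} A with find (λ v → A (true ∷ v)) | find (λ v → A (false ∷ v))
... | inj₁ (v , v∈) | _             = inj₁ (true ∷ v , v∈)
... | inj₂ _        | inj₁ (v , v∈) = inj₁ (false ∷ v , v∈)
... | inj₂ p        | inj₂ q        = inj₂ (cong₂ _+_ p q)

count≤1 : ∀ {n} (A : VSet n) → (∀ v w → v ∈ A → w ∈ A → v ≡ w) → count A ≤ 1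
count≤1 {zero}  A _ = bit-mono {A []} {true} _
count≤1 {suc n} A unique with find (λ v → A (true ∷ v)) | find (λ v → A (false ∷ v))
... | inj₁ (v , v∈) | inj₁ (w , w∈) = contradiction (unique _ _ v∈ w∈) λ ()
... | _ | inj₂ q rewrite q =
  subst (_≤ 1) (sym (+-identityʳ _)) (count≤1 _ λ v w p r → ∷-injectiveʳ (unique _ _ p r))
... | inj₂ p | _ rewrite p = count≤1 _ λ v w p r → ∷-injectiveʳ (unique _ _ p r)

below : ∀ {n} → (Vertex n → ℕ) → ℕ → VSet n
below f x v = f v <ᵇ x

module _ {n} (f : Vertex n → ℕ) (injective : ∀ {v w} → f v ≡ f w → v ≡ w) where

  private
    exactly : ℕ → VSet n
    exactly x v = f v ≡ᵇ x

  count-below-step : ∀ x → count (below f (suc x)) ≤ count (below f x) + count (exactly x)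
  count-below-step x = subst (count (below f (suc x)) ≤_)
    (sumV-+ (λ v → bit (below f x v)) (λ v → bit (exactly x v))) (sumV-mono pointwise)
    where
    pointwise : ∀ v → bit (f v <ᵇ suc x) ≤ bit (f v <ᵇ x) + bit (f v ≡ᵇ x)
    pointwise v with f v <? x
    ... | yes lt = ≤-trans (bit-mono {f v <ᵇ suc x} {true} _)
                     (≤-trans (bit-T (<⇒<ᵇ lt)) (m≤m+n _ (bit (f v ≡ᵇ x))))
    ... | no ¬lt = ≤-trans (bit-mono {f v <ᵇ suc x} {f v ≡ᵇ x}
                       (λ p → ≡⇒≡ᵇ (f v) x (≤-antisym (≤-pred (<ᵇ⇒< (f v) (suc x) p)) (≮⇒≥ ¬lt))))
                     (m≤n+m _ (bit (f v <ᵇ x)))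

  count-exactly : ∀ x → count (exactly x) ≤ 1
  count-exactly x = count≤1 (exactly x) λ v w p q →
    injective (trans (≡ᵇ⇒≡ (f v) x p) (sym (≡ᵇ⇒≡ (f w) x q)))

  count-below-≤ : ∀ x → count (below f x) ≤ x
  count-below-≤ zero    = ≤-reflexive (n≤0⇒n≡0 (subst (_≤ 0) refl
    (≤-trans (sumV-mono {f = λ v → bit (below f 0 v)} {g = λ _ → 0} (λ v → z≤n)) (≤-reflexive (sumV-0 n)))))
    where
    sumV-0 : ∀ n → sumV {n} (λ _ → 0) ≡ 0
    sumV-0 zero    = refl
    sumV-0 (suc n) = cong₂ _+_ (sumV-0 n) (sumV-0 n)
  count-below-≤ (suc x) = ≤-trans (count-below-step x)
    (≤-trans (+-mono-≤ (count-below-≤ x) (count-exactly x)) (≤-reflexive (+-comm x 1)))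

  count-below-+ : ∀ x d → count (below f (d + x)) ≤ d + count (below f x)
  count-below-+ x zero    = ≤-refl
  count-below-+ x (suc d) =
    ≤-trans (count-below-step (d + x))
      (≤-trans (+-mono-≤ (count-below-+ x d) (count-exactly (d + x))) (≤-reflexive (+-comm _ 1)))

  module _ (bounded : ∀ v → f v < 2 ^ n) where

    -- Pigeonhole: each value is taken at most once, so the values from `x` on account for at most
    -- `2 ^ n ∸ x` of the 2^n vertices.
    count-below : ∀ x → x ≤ 2 ^ n → count (below f x) ≡ x
    count-below x x≤ = ≤-antisym (count-below-≤ x) (+-cancelˡ-≤ (2 ^ n ∸ x) _ _ (begin
      2 ^ n ∸ x + x                       ≡⟨ m∸n+n≡m x≤ ⟩
      2 ^ n                               ≡⟨ sumV-1 n ⟨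
      sumV {n} (λ _ → 1)                  ≤⟨ sumV-mono (λ v → bit-T (<⇒<ᵇ (bounded v))) ⟩
      count (below f (2 ^ n))             ≡⟨ cong (λ y → count (below f y)) (m∸n+n≡m x≤) ⟨
      count (below f (2 ^ n ∸ x + x))     ≤⟨ count-below-+ x (2 ^ n ∸ x) ⟩
      2 ^ n ∸ x + count (below f x)       ∎))
      where open ≤-Reasoning

    surjective : ∀ x → x < 2 ^ n → ∃ λ v → f v ≡ x
    surjective x x< with find (exactly x)
    ... | inj₁ (v , v∈) = v , ≡ᵇ⇒≡ (f v) x v∈
    ... | inj₂ none = contradiction (subst₂ _≤_ (count-below (suc x) x<)
            (trans (cong₂ _+_ (count-below x (<⇒≤ x<)) none) (+-identityʳ x)) (count-below-step x))
            (n≮n x)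

Init : ∀ {n} → ℕ → VSet n
Init = below pos

∈Init : ∀ {n} x (v : Vertex n) → pos v < x → v ∈ Init x
∈Init x v = <⇒<ᵇ

Init∈ : ∀ {n} x (v : Vertex n) → v ∈ Init x → pos v < x
Init∈ x v = <ᵇ⇒< (pos v) x

count-Init≤ : ∀ n x → count (Init {n} x) ≤ x
count-Init≤ n = count-below-≤ {n} pos pos-injective

count-Init : ∀ n x → x ≤ 2 ^ n → count (Init {n} x) ≡ x
count-Init n = count-below {n} pos pos-injective pos<2^n

Closed : ∀ {n} → VSet n → Set
Closed A = ∀ v w → pos v ≤ pos w → w ∈ A → v ∈ A

-- `A` contains all pos v + 1 vertices up to `v`. With `Init⇒closed` this identifies a closed set
-- with the initial segment of its size.
closed⇒Init : ∀ {n} {A : VSet n} → Closed A → ∀ v → v ∈ A → pos v < count A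
closed⇒Init {n} {A} closed v v∈ = subst (_≤ count A) (count-Init n (suc (pos v)) (pos<2^n v))
  (count-mono λ u u∈ → closed u v (≤-pred (Init∈ (suc (pos v)) u u∈)) v∈)

Init⇒closed : ∀ {n} {A : VSet n} → Closed A → ∀ v → pos v < count A → v ∈ A
Init⇒closed {n} {A} closed v lt with A v in eq
... | true  = tt
... | false = contradiction (≤-trans (count-mono {A = A} {Init (pos v)} late) (count-Init≤ n (pos v))) (<⇒≱ lt)
  where
  late : A ⊆ Init (pos v)
  late u u∈ = ∈Init (pos v) u (≰⇒> λ v≤u → subst T eq (closed v u v≤u u∈))

-- The closed neighbourhood: at each coordinate either flip it or go on, and the base case keeps the
-- vertex itself.
nb : ∀ {n} → VSet n → VSet n
nb A []      = A []
nb A (b ∷ v) = nb (λ u → A (b ∷ u)) v ∨ A (not b ∷ v)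

-- The recursion of `nb` splits along the first coordinate; compression needs the same splitting
-- along any coordinate.
nb-insertAt : ∀ {n} (A : VSet (suc n)) i b v → nb A (insertAt v i b) ≡
              nb (λ u → A (insertAt u i b)) v ∨ A (insertAt v i (not b))
nb-insertAt A zero    b v       = refl
nb-insertAt A (suc i) b (c ∷ v) = begin
  nb (λ u → A (c ∷ u)) (insertAt v i b) ∨ q
    ≡⟨ cong (_∨ q) (nb-insertAt (λ u → A (c ∷ u)) i b v) ⟩
  (p ∨ r) ∨ q ≡⟨ ∨-assoc p r q ⟩
  p ∨ (r ∨ q) ≡⟨ cong (p ∨_) (∨-comm r q) ⟩
  p ∨ (q ∨ r) ≡⟨ ∨-assoc p q r ⟨
  (p ∨ q) ∨ r ∎
  where
  open ≡-Reasoning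
  p = nb (λ u → A (c ∷ insertAt u i b)) v
  q = A (not c ∷ insertAt v i b)
  r = A (c ∷ insertAt v i (not b))

nb⇒near : ∀ {n} (A : VSet n) v → v ∈ nb A → ∃ λ u → hamming u v ≤ 1 × u ∈ A
nb⇒near A []      v∈ = [] , z≤n , v∈
nb⇒near A (b ∷ v) v∈ with Equivalence.to T-∨ v∈
... | inj₁ same with nb⇒near (λ u → A (b ∷ u)) v same
nb⇒near A (true  ∷ v) v∈ | inj₁ same | u , near , u∈ = true ∷ u , near , u∈
nb⇒near A (false ∷ v) v∈ | inj₁ same | u , near , u∈ = false ∷ u , near , u∈
nb⇒near A (true  ∷ v) v∈ | inj₂ flip = false ∷ v , s≤s (≤-reflexive (hamming-refl v)) , flip
nb⇒near A (false ∷ v) v∈ | inj₂ flip = true ∷ v , s≤s (≤-reflexive (hamming-refl v)) , flip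

near⇒nb : ∀ {n} (A : VSet n) u v → hamming u v ≤ 1 → u ∈ A → v ∈ nb A
near⇒nb A []          []          _    u∈ = u∈
near⇒nb A (true  ∷ u) (true  ∷ v) near u∈ = Equivalence.from T-∨ (inj₁ (near⇒nb _ u v near u∈))
near⇒nb A (false ∷ u) (false ∷ v) near u∈ = Equivalence.from T-∨ (inj₁ (near⇒nb _ u v near u∈))
near⇒nb A (true  ∷ u) (false ∷ v) (s≤s near) u∈ with hamming0⇒≡ {u = u} {v} near
... | refl = Equivalence.from (T-∨ {nb (λ w → A (false ∷ w)) u}) (inj₂ u∈)
near⇒nb A (false ∷ u) (true  ∷ v) (s≤s near) u∈ with hamming0⇒≡ {u = u} {v} near
... | refl = Equivalence.from (T-∨ {nb (λ w → A (true ∷ w)) u}) (inj₂ u∈)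

nb-mono : ∀ {n} {A B : VSet n} → A ⊆ B → nb A ⊆ nb B
nb-mono {A = A} {B} A⊆B v v∈ with nb⇒near A v v∈
... | u , near , u∈ = near⇒nb B u v near (A⊆B u u∈)

nb-Init⇒ : ∀ {n} x (v : Vertex n) → v ∈ nb (Init x) → pos (first v) < x
nb-Init⇒ x v v∈ with nb⇒near (Init x) v v∈
... | u , near , u∈ = ≤-trans (s≤s (first-least {u = u} {v} near)) (Init∈ x u u∈)

⇒nb-Init : ∀ {n} x (v : Vertex n) → pos (first v) < x → v ∈ nb (Init x)
⇒nb-Init x v lt = near⇒nb (Init x) (first v) v (hamming-first v) (∈Init x (first v) lt)

Init-closed : ∀ {n} x → Closed (Init {n} x)
Init-closed x v w v≤w w∈ = ∈Init x v (≤-trans (s≤s v≤w) (Init∈ x w w∈))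

nb-Init-closed : ∀ {n} x → Closed (nb (Init {n} x))
nb-Init-closed x v w v≤w w∈ =
  ⇒nb-Init x v (≤-trans (s≤s (first-mono {v = v} {w} v≤w)) (nb-Init⇒ x w w∈))

-- Initial segments are nested, so their union is no larger than the larger of them.
count-∪-closed : ∀ {n} {A B : VSet n} {c} → Closed A → Closed B → count A ≤ c → count B ≤ c →
                 count (A ∪ B) ≤ c
count-∪-closed {n} {A} {B} {c} closedA closedB A≤c B≤c =
  ≤-trans (count-mono {B = Init c} inside) (count-Init≤ n c)
  where
  inside : A ∪ B ⊆ Init c
  inside v v∈ with Equivalence.to (T-∨ {A v}) v∈
  ... | inj₁ v∈A = ∈Init c v (≤-trans (closed⇒Init closedA v v∈A) A≤c)
  ... | inj₂ v∈B = ∈Init c v (≤-trans (closed⇒Init closedB v v∈B) B≤c)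

-- Harper's theorem

any-vertex? : ∀ {n} {P : Vertex n → Set} → (∀ v → Dec (P v)) → Dec (∃ P)
any-vertex? {zero}  P? = map′ (λ p → [] , p) (λ { ([] , p) → p }) (P? [])
any-vertex? {suc n} P? = map′
  (λ { (inj₁ (v , p)) → true ∷ v , p ; (inj₂ (v , p)) → false ∷ v , p })
  (λ { (true ∷ v , p) → inj₁ (v , p) ; (false ∷ v , p) → inj₂ (v , p) })
  (any-vertex? (λ v → P? (true ∷ v)) ⊎-dec any-vertex? (λ v → P? (false ∷ v)))

-- In each of the two facets orthogonal to direction `i`, the slice of `A` is replaced by the
-- initial segment of the same size.
compress : ∀ {n} → Fin (suc n) → VSet (suc n) → VSet (suc n)
compress i A v = pos (removeAt v i) <ᵇ count (λ u → A (insertAt u i (lookup v i)))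

compress-insertAt : ∀ {n} i (A : VSet (suc n)) b v →
                    compress i A (insertAt v i b) ≡ Init (count (λ u → A (insertAt u i b))) v
compress-insertAt i A b v rewrite removeAt-insertAt v i b | insertAt-lookup v i b = refl

count-compress : ∀ {n} i (A : VSet (suc n)) → count (compress i A) ≡ count A
count-compress {n} i A = begin
  count (compress i A)
    ≡⟨ sumV-insertAt (λ v → bit (compress i A v)) i ⟩
  count (λ v → compress i A (insertAt v i true)) + count (λ v → compress i A (insertAt v i false))
    ≡⟨ cong₂ _+_ (slice true) (slice false) ⟩
  count (λ v → A (insertAt v i true)) + count (λ v → A (insertAt v i false))
    ≡⟨ sumV-insertAt (λ v → bit (A v)) i ⟨
  count A ∎
  where
  open ≡-Reasoning
  slice : ∀ b → count (λ v → compress i A (insertAt v i b)) ≡ count (λ v → A (insertAt v i b))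
  slice b = trans (sumV-cong (λ v → cong bit (compress-insertAt i A b v)))
                  (count-Init n _ (count≤2^n (λ v → A (insertAt v i b))))

val : Bool → ℕ → ℕ
val true  m = m
val false m = 0

sumV-val : ∀ {n} (A : VSet n) G → sumV (λ v → val (A v) G) ≡ count A * G
sumV-val {zero} A G with A []
... | true  = sym (+-identityʳ G)
... | false = refl
sumV-val {suc n} A G = trans (cong₂ _+_ (sumV-val (λ v → A (true ∷ v)) G) (sumV-val (λ v → A (false ∷ v)) G))
  (sym (*-distribʳ-+ G (count (λ v → A (true ∷ v))) (count (λ v → A (false ∷ v)))))

module _ {n} (g : Vertex n → ℕ) (g-mono : ∀ v w → pos v < pos w → g v < g w) where

  threshold : ∀ s → ∃ λ G → (∀ v → pos v < s → g v < G) × (∀ v → s ≤ pos v → G ≤ g v)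
  threshold s with s <? 2 ^ n
  -- All vertices are early here, so any value above all of `g` serves.
  ... | no s≮ = suc (sumV g) , (λ v _ → s≤s (≤sumV g v)) ,
                λ v s≤ → contradiction (≤-trans (s≤s s≤) (pos<2^n v)) s≮
  ... | yes s< with surjective pos pos-injective pos<2^n s s<
  ...   | u , eq = g u , (λ v lt → g-mono v u (subst (pos v <_) (sym eq) lt)) ,
                   λ v s≤ → late v (subst (_≤ pos v) (sym eq) s≤)
    where
    late : ∀ v → pos u ≤ pos v → g u ≤ g v
    late v le with m≤n⇒m<n∨m≡n le
    ... | inj₁ lt = <⇒≤ (g-mono u v lt)
    ... | inj₂ eq = ≤-reflexive (cong g (pos-injective eq))

  private
    -- This is ([d] - [a]) (m - G) ≤ 0 without subtraction.
    exchange : ∀ {m G} d a → (T d → m < G) → (¬ T d → G ≤ m) →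
               val d m + val a G ≤ val a m + val d G
    exchange true  true  _  _  = ≤-reflexive refl
    exchange {m} true  false lt _  = ≤-trans (≤-reflexive (+-identityʳ m)) (<⇒≤ (lt tt))
    exchange {m} false true  _  ge = ≤-trans (ge λ ()) (≤-reflexive (sym (+-identityʳ m)))
    exchange false false _  _  = z≤n

  module _ (A : VSet n) where

    private
      s = count A
      D = Init {n} s
      G = proj₁ (threshold s)
      early = proj₁ (proj₂ (threshold s))
      late = proj₂ (proj₂ (threshold s))

      left right : Vertex n → ℕ
      left  v = val (D v) (g v) + val (A v) G
      right v = val (A v) (g v) + val (D v) G

      left≤right : ∀ v → left v ≤ right v
      left≤right v = exchange (D v) (A v) (λ v∈ → early v (Init∈ s v v∈))
        (λ v∉ → late v (≮⇒≥ λ lt → v∉ (∈Init s v lt)))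

      sum-left : sumV left ≡ sumV (λ v → val (D v) (g v)) + s * G
      sum-left = trans (sumV-+ (λ v → val (D v) (g v)) _) (cong (sumV (λ v → val (D v) (g v)) +_) (sumV-val A G))

      sum-right : sumV right ≡ sumV (λ v → val (A v) (g v)) + s * G
      sum-right = trans (sumV-+ (λ v → val (A v) (g v)) _) (cong (sumV (λ v → val (A v) (g v)) +_)
        (trans (sumV-val D G) (cong (_* G) (count-Init n s (count≤2^n A)))))

    -- Sum `exchange` over all vertices: the two sets have the same size, so the terms with the
    -- threshold `G` cancel.
    Init-lightest : sumV (λ v → val (Init (count A) v) (g v)) ≤ sumV (λ v → val (A v) (g v))
    Init-lightest = +-cancelʳ-≤ (s * G) _ _ (subst₂ _≤_ sum-left sum-right (sumV-mono left≤right))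

    Init-lighter : ∀ x y → pos x < pos y → ¬ x ∈ A → y ∈ A →
                   sumV (λ v → val (Init (count A) v) (g v)) < sumV (λ v → val (A v) (g v))
    Init-lighter x y x<y x∉ y∈ = +-cancelʳ-< (s * G) _ _ (subst₂ _<_ sum-left sum-right strict)
      where
      strict-x : ∀ {m G} d a → ¬ T a → T d → m < G → val d m + val a G < val a m + val d G
      strict-x {m} true  false _ _ lt = ≤-trans (s≤s (≤-reflexive (+-identityʳ m))) lt
      strict-x     true  true  ¬a _ _ = contradiction tt ¬a
      strict-y : ∀ {m G} d a → T a → ¬ T d → G < m → val d m + val a G < val a m + val d G
      strict-y {m} false true _ _ lt = ≤-trans lt (≤-reflexive (sym (+-identityʳ m)))
      strict-y     true  true _ ¬d _ = contradiction tt ¬d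
      strict : sumV left < sumV right
      -- Strictness occurs at `x` if it lies in the initial segment, where g x < G; otherwise at the
      -- later `y`, where G ≤ g x < g y.
      strict with pos x <? s
      ... | yes x<s = sumV-strict left≤right x (strict-x (D x) (A x) x∉ (∈Init s x x<s) (early x x<s))
      ... | no x≮s = sumV-strict left≤right y (strict-y (D y) (A y) y∈
            (λ y∈D → x≮s (<-trans x<y (Init∈ s y y∈D)))
            (≤-trans (s≤s (late x (≮⇒≥ x≮s))) (g-mono x y x<y)))

-- The potential for the induction in `harper-descent`.
cost : ∀ {n} → VSet n → ℕ
cost A = sumV (λ v → val (A v) (pos v))

module _ {n} (i : Fin (suc n)) (A : VSet (suc n)) where

  private
    slice : Bool → VSet n
    slice b v = A (insertAt v i b)

    cost-slice : VSet (suc n) → Bool → ℕ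
    cost-slice B b = sumV (λ v → val (B (insertAt v i b)) (pos (insertAt v i b)))

    slice-compress : ∀ b → cost-slice (compress i A) b ≡
                     sumV (λ v → val (Init (count (slice b)) v) (pos (insertAt v i b)))
    slice-compress b = sumV-cong λ v → cong (λ c → val c (pos (insertAt v i b))) (compress-insertAt i A b v)

    lightest : ∀ b → cost-slice (compress i A) b ≤ cost-slice A b
    lightest b = subst (_≤ cost-slice A b) (sym (slice-compress b))
      (Init-lightest (λ v → pos (insertAt v i b)) (λ v w → pos-insertAt i b) (slice b))

  cost-compress : ∀ b x y → pos x < pos y → ¬ insertAt x i b ∈ A → insertAt y i b ∈ A →
                  cost (compress i A) < cost A
  cost-compress b x y x<y x∉ y∈ = subst₂ _<_
    (sym (sumV-insertAt (λ v → val (compress i A v) (pos v)) i))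
    (sym (sumV-insertAt (λ v → val (A v) (pos v)) i)) (total b x∉ y∈)
    where
    lighter : ∀ b → ¬ insertAt x i b ∈ A → insertAt y i b ∈ A →
              cost-slice (compress i A) b < cost-slice A b
    lighter b x∉ y∈ = subst (_< cost-slice A b) (sym (slice-compress b))
      (Init-lighter (λ v → pos (insertAt v i b)) (λ v w → pos-insertAt i b) (slice b) x y x<y x∉ y∈)
    total : ∀ b → ¬ insertAt x i b ∈ A → insertAt y i b ∈ A →
            cost-slice (compress i A) true + cost-slice (compress i A) false <
            cost-slice A true + cost-slice A false
    total true  x∉ y∈ = +-mono-<-≤ (lighter true x∉ y∈) (lightest false)
    total false x∉ y∈ = +-mono-≤-< (lightest true) (lighter false x∉ y∈)

  -- In facet `b` the new neighbourhood lies in the union of the neighbourhood of one initial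
  -- segment with another initial segment. These are nested, and each is bounded by the old
  -- neighbourhood in that facet: the first by Harper's theorem one dimension lower, the second by
  -- its size.
  count-nb-compress : (∀ (B : VSet n) → count (nb (Init {n} (count B))) ≤ count (nb B)) →
                      count (nb (compress i A)) ≤ count (nb A)
  count-nb-compress harper = subst₂ _≤_
    (sym (sumV-insertAt (λ v → bit (nb (compress i A) v)) i))
    (sym (sumV-insertAt (λ v → bit (nb A v)) i))
    (+-mono-≤ (part true) (part false))
    where
    rewritten : ∀ b → (λ v → nb (compress i A) (insertAt v i b)) ⊆
                      (nb (Init (count (slice b))) ∪ Init (count (slice (not b))))
    rewritten b v v∈ with Equivalence.to T-∨ (subst T (nb-insertAt (compress i A) i b v) v∈)
    ... | inj₁ p = Equivalence.from T-∨ (inj₁ (nb-mono {B = Init (count (slice b))}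
                     (λ u → subst T (compress-insertAt i A b u)) v p))
    ... | inj₂ p = Equivalence.from (T-∨ {nb (Init (count (slice b))) v})
                     (inj₂ (subst T (compress-insertAt i A (not b) v) p))
    part : ∀ b → count (λ v → nb (compress i A) (insertAt v i b)) ≤ count (λ v → nb A (insertAt v i b))
    part b = ≤-trans (count-mono (rewritten b))
      (subst (count {n} (nb (Init (count (slice b))) ∪ Init (count (slice (not b)))) ≤_)
      (sym (sumV-cong (λ v → cong bit (nb-insertAt A i b v))))
      (count-∪-closed {n} {nb (Init (count (slice b)))} {Init (count (slice (not b)))}
        (nb-Init-closed (count (slice b))) (Init-closed (count (slice (not b))))
        (≤-trans (harper (slice b)) (count-mono {A = nb (slice b)} {nb (slice b) ∪ slice (not b)}
          (λ v p → Equivalence.from T-∨ (inj₁ p))))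
        (≤-trans (≤-reflexive (count-Init n _ (count≤2^n (slice (not b)))))
          (count-mono {A = slice (not b)} {nb (slice b) ∪ slice (not b)}
            (λ v p → Equivalence.from (T-∨ {nb (slice b) v}) (inj₂ p))))))

-- Consecutive antipodal vertices

Antipodal : ∀ {n} → Vertex n → Vertex n → Set
Antipodal x y = ∀ i → lookup x i ≢ lookup y i

antipodal-unique : ∀ {n} (x y z : Vertex n) → Antipodal x y → Antipodal z y → x ≡ z
antipodal-unique []      []      []      _ _ = refl
antipodal-unique (a ∷ x) (b ∷ y) (c ∷ z) p q = cong₂ _∷_ (agree a b c (p zero) (q zero))
  (antipodal-unique x y z (p ∘ suc) (q ∘ suc))
  where
  agree : ∀ a b c → a ≢ b → c ≢ b → a ≡ c
  agree true  _     true  _  _  = refl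
  agree false _     false _  _  = refl
  agree true  true  false p  _  = contradiction refl p
  agree true  false false _  q  = contradiction refl q
  agree false true  true  _  q  = contradiction refl q
  agree false false true  p  _  = contradiction refl p

antipodal-weight : ∀ {n} (x y : Vertex n) → Antipodal x y → weight x + weight y ≡ n
antipodal-weight []          []          _ = refl
antipodal-weight (true  ∷ x) (true  ∷ y) p = contradiction refl (p zero)
antipodal-weight (true  ∷ x) (false ∷ y) p = cong suc (antipodal-weight x y (p ∘ suc))
antipodal-weight (false ∷ x) (true  ∷ y) p =
  trans (+-suc (weight x) (weight y)) (cong suc (antipodal-weight x y (p ∘ suc)))
antipodal-weight (false ∷ x) (false ∷ y) p = contradiction refl (p zero)

-- Moving the last true coordinate of first w further back.
later-of-weight : ∀ {n} (w : Vertex n) {r} → weight (first w) ≡ suc r →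
                  ∃ λ (z : Vertex n) → weight z ≡ weight (first w) × pos (first w) < pos z
later-of-weight {suc n} (c ∷ v) {r} wt with first-cases c v
... | inj₁ (wv , eq) rewrite eq = contradiction (trans (sym wt) wv) λ ()
... | inj₂ (zero , wv , eq) rewrite eq = go c wt
  where
  w0 : weight (first v) ≡ 0
  w0 = weight-first v wv
  go : ∀ c → bit c + weight (first v) ≡ suc r →
       ∃ λ (z : Vertex (suc n)) → weight z ≡ bit c + weight (first v) × pos (c ∷ first v) < pos z
  go true  _  = false ∷ v , trans wv (cong suc (sym w0)) ,
    +-mono-<-≤ (weight<⇒pos< {v = first v} {v} (subst₂ _<_ (sym w0) (sym wv) (s≤s z≤n)))
      (≤-reflexive (cong (ball n) (trans (cong suc w0) (sym wv))))
  go false wt = contradiction (trans (sym wt) w0) λ ()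
... | inj₂ (suc r′ , wv , eq) rewrite eq with later-of-weight v (weight-first v wv)
...   | z , wz , z> = c ∷ z , cong (bit c +_) wz ,
        +-mono-<-≤ z> (≤-reflexive (cong (λ x → ball n (bit c + x)) (sym wz)))

unit-vertex : ∀ n → ∃ λ (v : Vertex (suc n)) → weight v ≡ 1
unit-vertex zero    = true ∷ [] , refl
unit-vertex (suc n) with unit-vertex n
... | v , eq = false ∷ v , eq

Consecutive : ∀ {n} → Vertex n → Vertex n → Set
Consecutive {n} x y = pos x < pos y × (∀ (z : Vertex n) → pos x < pos z → pos z < pos y → ⊥)

-- If the tail `x` is zero, then `y` is all true, and some vertex of weight one lies strictly
-- between the pair.
antipodal-light : ∀ {n} b c (x y : Vertex (2 + n)) → Antipodal (b ∷ x) (c ∷ y) →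
                  Consecutive (b ∷ x) (c ∷ y) → weight x ≢ 0
antipodal-light {n} b c x y anti (_ , gap) wx = light b c anti gap
  where
  wy : weight y ≡ 2 + n
  wy = trans (cong (_+ weight y) (sym wx)) (antipodal-weight x y (anti ∘ suc))
  light : ∀ b c → Antipodal (b ∷ x) (c ∷ y) →
          (∀ (z : Vertex (3 + n)) → pos (b ∷ x) < pos z → pos z < pos (c ∷ y) → ⊥) → ⊥
  light true  true  anti _ = anti zero refl
  light false false anti _ = anti zero refl
  light true  false _ gap with unit-vertex (suc n)
  ... | u , wu = gap (false ∷ u)
        (+-mono-<-≤ (weight<⇒pos< {v = x} {u} (subst₂ _<_ (sym wx) (sym wu) (s≤s z≤n)))
          (≤-reflexive (cong (ball (2 + n)) (trans (cong suc wx) (sym wu)))))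
        (weight<⇒pos< {v = false ∷ u} {false ∷ y} (subst₂ _<_ (sym wu) (sym wy) (s≤s (s≤s z≤n))))
  light false true  _ gap = gap (true ∷ x)
        (weight<⇒pos< {v = false ∷ x} {true ∷ x} ≤-refl)
        (weight<⇒pos< {v = true ∷ x} {true ∷ y} (s≤s (subst₂ _<_ (sym wx) (sym wy) (s≤s z≤n))))

-- Replacing the tail `first w` by a later `z` of the same weight gives a vertex strictly between.
-- If the two weights agree, the earlier vertex must have head `true`, so `b ∷ z` still precedes
-- `c ∷ y`.
antipodal-heavy : ∀ {n} b c (w y : Vertex (2 + n)) → Antipodal (b ∷ first w) (c ∷ y) →
                  Consecutive (b ∷ first w) (c ∷ y) → ∀ {r} → weight (first w) ≢ suc r
antipodal-heavy {n} b c w y anti (x<y , gap) wx with later-of-weight w wx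
... | z , wz , x<z = gap (b ∷ z)
        (+-mono-<-≤ x<z (≤-reflexive (cong (λ k → ball (2 + n) (bit b + k)) (sym wz))))
        z<y
  where
  x = first w
  same-weight : ∀ b c → Antipodal (b ∷ x) (c ∷ y) → pos (b ∷ x) < pos (c ∷ y) →
                bit b + weight x ≡ bit c + weight y → pos (b ∷ z) < pos (c ∷ y)
  same-weight true  true  anti _ _ = contradiction refl (anti zero)
  same-weight false false anti _ _ = contradiction refl (anti zero)
  same-weight true  false _ _ eqw =
    +-mono-<-≤ (weight<⇒pos< {v = z} {y} (subst₂ _<_ (sym wz) eqw ≤-refl))
      (≤-reflexive (cong (ball (2 + n)) (trans (cong suc wz) eqw)))
  same-weight false true  _ lt eqw = contradiction
    (pos≤⇒weight≤ {v = x} {y} (<⇒≤ (+-cancelʳ-< (ball (2 + n) (weight x)) (pos x) (pos y)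
      (subst (λ k → pos x + ball (2 + n) (weight x) < pos y + ball (2 + n) k) (sym eqw) lt))))
    (λ le → n≮n (weight y) (subst (_≤ weight y) eqw le))
  z<y : pos (b ∷ z) < pos (c ∷ y)
  z<y with weight-lex {v = b ∷ x} {c ∷ y} x<y
  ... | inj₁ lighter = weight<⇒pos< {v = b ∷ z} {c ∷ y}
          (subst (λ k → bit b + k < bit c + weight y) (sym wz) lighter)
  ... | inj₂ eqw = same-weight b c anti x<y eqw

-- In dimension at least three the first vertex of a consecutive antipodal pair ends in true.
antipodal-not-first : ∀ {n} (x y : Vertex (3 + n)) → Antipodal x y → Consecutive x y →
                      ∀ w → first w ≢ x
antipodal-not-first (b ∷ x) (c ∷ y) anti consecutive (d ∷ w) eq with first-cases d w
... | inj₁ (ww , eq′) with trans (sym eq′) eq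
...   | refl = antipodal-light b c x y anti consecutive ww
antipodal-not-first (b ∷ x) (c ∷ y) anti consecutive (d ∷ w) eq | inj₂ (_ , _ , eq′)
  with trans (sym eq′) eq
... | refl = go (weight x) refl
  where
  go : ∀ r → weight x ≢ r
  go zero    = antipodal-light b c x y anti consecutive
  go (suc r) = antipodal-heavy b c w y anti consecutive

bool? : ∀ {P : Bool → Set} → (∀ b → Dec (P b)) → Dec (∀ b → P b)
bool? P? = map′ (λ { (p , q) true → p ; (p , q) false → q }) (λ f → f true , f false)
                (P? true ×-dec P? false)

-- `antipodal-not-first` fails in dimensions one and two, so these are checked exhaustively. `count`
-- and `nb` unfold to the values of `A`, which makes a table of sets enough.
harper₁ : ∀ (A : VSet 1) → count (nb (Init {1} (count A))) ≤ count (nb A)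
harper₁ A = table (A (true ∷ [])) (A (false ∷ []))
  where
  set : Bool → Bool → VSet 1
  set a b (true  ∷ []) = a
  set a b (false ∷ []) = b
  table : ∀ a b → count (nb (Init {1} (count (set a b)))) ≤ count (nb (set a b))
  table = toWitness {a? = bool? λ a → bool? λ b → _ ≤? _} tt

harper₂ : ∀ (A : VSet 2) → count (nb (Init {2} (count A))) ≤ count (nb A)
harper₂ A = table (A (true ∷ true ∷ [])) (A (true ∷ false ∷ []))
                  (A (false ∷ true ∷ [])) (A (false ∷ false ∷ []))
  where
  set : Bool → Bool → Bool → Bool → VSet 2
  set a b c d (true  ∷ true  ∷ []) = a
  set a b c d (true  ∷ false ∷ []) = b
  set a b c d (false ∷ true  ∷ []) = c
  set a b c d (false ∷ false ∷ []) = d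
  table : ∀ a b c d → count (nb (Init {2} (count (set a b c d)))) ≤ count (nb (set a b c d))
  table = toWitness {a? = bool? λ a → bool? λ b → bool? λ c → bool? λ d → _ ≤? _} tt

nb-mono-count : ∀ {n} {A B : VSet n} → A ⊆ B → count (nb A) ≤ count (nb B)
nb-mono-count A⊆B = count-mono (nb-mono A⊆B)

harper-closed : ∀ {n} {A : VSet n} → Closed A → count (nb (Init {n} (count A))) ≤ count (nb A)
harper-closed {A = A} closed = nb-mono-count λ v v∈ → Init⇒closed closed v (Init∈ (count A) v v∈)

count-∪ : ∀ {n} (A B : VSet n) → count (A ∪ B) ≤ count A + count B
count-∪ A B = subst (count (A ∪ B) ≤_) (sumV-+ (λ v → bit (A v)) (λ v → bit (B v)))
  (sumV-mono λ v → bit-∨ (A v) (B v))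
  where
  bit-∨ : ∀ a b → bit (a ∨ b) ≤ bit a + bit b
  bit-∨ true  b = s≤s z≤n
  bit-∨ false b = ≤-refl

-- A set that no compression changes misses x and contains y > x only for antipodal x and y.
harper-antipodal : ∀ {n} (A : VSet (3 + n)) x y → pos x < pos y → ¬ x ∈ A → y ∈ A →
                   (∀ u v → pos u < pos v → ¬ u ∈ A → v ∈ A → Antipodal u v) →
                   count (nb (Init {3 + n} (count A))) ≤ count (nb A)
harper-antipodal {n} A x y x<y x∉ y∈ anti =
  ≤-trans (nb-mono-count {3 + n} {A = Init (count A)} {Init (suc (pos x))} initial) (count-mono {3 + n} covered)
  where
  before : ∀ z → pos z < pos y → z ≢ x → z ∈ A
  before z z<y z≢x with T? (A z)
  ... | yes z∈ = z∈
  ... | no z∉ = contradiction (antipodal-unique z y x (anti z y z<y z∉ y∈) (anti x y x<y x∉ y∈)) z≢x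
  after : ∀ z → pos x < pos z → z ∈ A → z ≡ y
  after z x<z z∈ = antipodal-unique z x y (λ i → anti x z x<z x∉ z∈ i ∘ sym) (λ i → anti x y x<y x∉ y∈ i ∘ sym)
  consecutive : Consecutive x y
  consecutive = x<y , λ z x<z z<y → n≮n (pos y) (subst (λ u → pos u < pos y)
    (after z x<z (before z z<y λ { refl → n≮n (pos x) x<z })) z<y)
  only : VSet (3 + n)
  only v = pos v Data.Nat.≡ᵇ pos y
  inside : A ⊆ Init (pos x) ∪ only
  inside v v∈ with <-cmp (pos v) (pos x)
  ... | tri< v<x _ _ = Equivalence.from T-∨ (inj₁ (∈Init (pos x) v v<x))
  ... | tri≈ _ v≡x _ = contradiction (subst (_∈ A) (pos-injective v≡x) v∈) x∉
  ... | tri> _ _ x<v = Equivalence.from (T-∨ {Init (pos x) v})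
          (inj₂ (≡⇒≡ᵇ (pos v) (pos y) (cong pos (after v x<v v∈))))
  size : count A ≤ suc (pos x)
  size = begin
    count A                          ≤⟨ count-mono inside ⟩
    count (Init (pos x) ∪ only)      ≤⟨ count-∪ (Init (pos x)) only ⟩
    count {3 + n} (Init (pos x)) + count only
      ≤⟨ +-mono-≤ (count-Init≤ (3 + n) (pos x)) (count-exactly {3 + n} pos pos-injective (pos y)) ⟩
    pos x + 1                        ≡⟨ +-comm (pos x) 1 ⟩
    suc (pos x)                      ∎
    where open ≤-Reasoning
  initial : Init (count A) ⊆ Init (suc (pos x))
  initial v v∈ = ∈Init (suc (pos x)) v (≤-trans (Init∈ (count A) v v∈) size)
  -- Each such `w` is equal or adjacent to `first w`, which precedes `y` and differs from `x`, hence
  -- lies in `A`.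
  covered : nb (Init (suc (pos x))) ⊆ nb A
  covered w w∈ = near⇒nb A (first w) w (hamming-first w) (before (first w)
    (≤-trans (s≤s (≤-pred (nb-Init⇒ (suc (pos x)) w w∈))) x<y)
    (antipodal-not-first x y (anti x y x<y x∉ y∈) consecutive w))

-- Descent by compressions

Bad : ∀ {n} → VSet n → Vertex n → Vertex n → Set
Bad A x y = pos x < pos y × ¬ x ∈ A × y ∈ A

bad? : ∀ {n} (A : VSet n) x y → Dec (Bad A x y)
bad? A x y = (pos x <? pos y) ×-dec (¬? (T? (A x)) ×-dec T? (A y))

agree? : ∀ {n} (x y : Vertex n) → Dec (∃ λ i → lookup x i ≡ lookup y i)
agree? x y = any? λ i → lookup x i Bool.≟ lookup y i

cost-compress-bad : ∀ {n} i (A : VSet (suc n)) x y → Bad A x y → lookup x i ≡ lookup y i →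
                    cost (compress i A) < cost A
cost-compress-bad i A x y (x<y , x∉ , y∈) eq =
  cost-compress i A (lookup x i) (removeAt x i) (removeAt y i) removed-<
    (x∉ ∘ subst (_∈ A) x≡) (subst (_∈ A) (sym y≡) y∈)
  where
  x≡ : insertAt (removeAt x i) i (lookup x i) ≡ x
  x≡ = insertAt-removeAt x i
  y≡ : insertAt (removeAt y i) i (lookup x i) ≡ y
  y≡ = trans (cong (insertAt (removeAt y i) i) eq) (insertAt-removeAt y i)
  removed-< : pos (removeAt x i) < pos (removeAt y i)
  removed-< with <-cmp (pos (removeAt x i)) (pos (removeAt y i))
  ... | tri< lt _ _ = lt
  ... | tri≈ _ e _ = contradiction (cong pos (trans (sym x≡)
          (trans (cong (λ v → insertAt v i (lookup x i)) (pos-injective e)) y≡))) (<⇒≢ x<y)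
  ... | tri> _ _ gt = contradiction (subst₂ _<_ (cong pos y≡) (cong pos x≡)
          (pos-insertAt i (lookup x i) gt)) (<⇒≯ x<y)

-- A bad pair agreeing in a coordinate lies in one facet, and compressing there lowers the cost
-- without enlarging the neighbourhood. Once no such pair is left, either a bad pair exists and all
-- of them are antipodal, or `A` is an initial segment.
harper-descent : ∀ {n} → (∀ (B : VSet (2 + n)) → count (nb (Init {2 + n} (count B))) ≤ count (nb B)) →
                 ∀ m (A : VSet (3 + n)) → cost A < m →
                 count (nb (Init {3 + n} (count A))) ≤ count (nb A)
harper-descent {n} smaller (suc m) A (s≤s cost≤m)
  with any-vertex? (λ x → any-vertex? (λ y → bad? A x y ×-dec agree? x y))
... | yes (x , y , bad , i , eq) = ≤-trans
        (subst (λ c → count (nb (Init {3 + n} c)) ≤ count (nb (compress i A))) (count-compress i A)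
          (harper-descent smaller m (compress i A) (≤-trans (cost-compress-bad i A x y bad eq) cost≤m)))
        (count-nb-compress i A (smaller))
... | no none with any-vertex? (λ x → any-vertex? (λ y → bad? A x y))
...   | yes (x , y , x<y , x∉ , y∈) = harper-antipodal A x y x<y x∉ y∈
          λ u v u<v u∉ v∈ i eq → none (u , v , (u<v , u∉ , v∈) , i , eq)
...   | no good = harper-closed {A = A} closed
  where
  closed : Closed A
  closed v w v≤w w∈ with T? (A v)
  ... | yes v∈ = v∈
  ... | no v∉ with m≤n⇒m<n∨m≡n v≤w
  ...   | inj₁ v<w = contradiction (v , w , v<w , v∉ , w∈) good
  ...   | inj₂ v≡w = subst (_∈ A) (sym (pos-injective v≡w)) w∈

harper : ∀ n (A : VSet n) → count (nb (Init {n} (count A))) ≤ count (nb A)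
harper zero                A = harper-closed {A = A} λ { [] [] _ []∈ → []∈ }
harper (suc zero)          A = harper₁ A
harper (suc (suc zero))    A = harper₂ A
harper (suc (suc (suc n))) A = harper-descent (harper (suc (suc n))) (suc (cost A)) A ≤-refl

-- Numberings

Expanding : ℕ → ℕ → Set
Expanding n s = ∀ (A : VSet n) → s ≤ count A → s + centralSum n ≤ count (nb A)

-- By Harper's theorem `A` may be replaced by an initial segment, which contains `first v`. By
-- `first-mono` its neighbourhood contains every vertex up to `v`, and the drop at `v` is the full
-- `centralSum n`.
critical-expanding : ∀ {n} (v : Vertex n) → pos (first v) + centralSum n ≡ pos v →
                     Expanding n (suc (pos (first v)))
critical-expanding {n} v drop A s≤ = begin
  suc (pos (first v)) + centralSum n       ≡⟨ cong suc drop ⟩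
  suc (pos v)                              ≡⟨ count-Init n (suc (pos v)) (pos<2^n v) ⟨
  count {n} (Init (suc (pos v)))           ≤⟨ count-mono covered ⟩
  count (nb {n} (Init (count A)))          ≤⟨ harper n A ⟩
  count (nb A)                             ∎
  where
  open ≤-Reasoning
  covered : Init (suc (pos v)) ⊆ nb (Init (count A))
  covered w w∈ = ⇒nb-Init (count A) w
    (≤-trans (s≤s (first-mono {v = w} {v} (≤-pred (Init∈ (suc (pos v)) w w∈)))) s≤)

parityOf : ∀ {n} → Vertex n → Bool
parityOf []      = false
parityOf (b ∷ v) = b xor parityOf v

-- The copies of v in the two colour classes of the cube of one dimension more.
lift : ∀ {n} → Bool → Vertex n → Vertex (suc n)
lift c v = (c xor parityOf v) ∷ v

hamming1⇒parity : ∀ {n} (u v : Vertex n) → hamming u v ≡ 1 → parityOf u ≡ not (parityOf v)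
hamming1⇒parity []          []          ()
hamming1⇒parity (true  ∷ u) (true  ∷ v) eq = cong not (hamming1⇒parity u v eq)
hamming1⇒parity (false ∷ u) (false ∷ v) eq = hamming1⇒parity u v eq
hamming1⇒parity (true  ∷ u) (false ∷ v) eq
  rewrite hamming0⇒≡ {u = u} {v} (≤-reflexive (suc-injective eq)) = refl
hamming1⇒parity (false ∷ u) (true  ∷ v) eq
  rewrite hamming0⇒≡ {u = u} {v} (≤-reflexive (suc-injective eq)) = sym (not-involutive (parityOf v))

hamming-flip : ∀ {n} b (u v : Vertex n) → hamming (b ∷ u) (not b ∷ v) ≡ suc (hamming u v)
hamming-flip true  u v = refl
hamming-flip false u v = refl

hamming-same : ∀ {n} b (u v : Vertex n) → hamming (b ∷ u) (b ∷ v) ≡ hamming u v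
hamming-same true  u v = refl
hamming-same false u v = refl

-- For equal projections opposite colours make the heads differ; for adjacent ones the parities
-- differ as well, so the heads agree.
lift-adjacent : ∀ {n} c (u v : Vertex n) → hamming u v ≤ 1 → hamming (lift c u) (lift (not c) v) ≡ 1
lift-adjacent c u v near with hamming u v in eq
... | zero with hamming0⇒≡ {u = u} {v} (≤-reflexive eq)
...   | refl = trans (cong (λ b → hamming ((c xor parityOf u) ∷ u) (b ∷ u)) (flip c (parityOf u)))
                 (trans (hamming-flip (c xor parityOf u) u u) (cong suc (hamming-refl u)))
  where
  flip : ∀ c p → not c xor p ≡ not (c xor p)
  flip true  p = sym (not-involutive p)
  flip false p = refl
lift-adjacent c u v near | suc zero =
  trans (cong (λ b → hamming (b ∷ u) ((not c xor parityOf v) ∷ v))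
          (trans (cong (c xor_) (hamming1⇒parity u v eq)) (same c (parityOf v))))
    (trans (hamming-same (not c xor parityOf v) u v) eq)
  where
  same : ∀ c p → c xor not p ≡ not c xor p
  same true  p = not-involutive p
  same false p = refl
lift-adjacent c u v (s≤s ()) | suc (suc _)

gap-≥ : ∀ {k} a b → a + k ≤ b ⊎ b + k ≤ a → k ≤ ∣ a - b ∣
gap-≥ {k} a b (inj₁ p) = ≤-trans (m+n≤o⇒m≤o∸n k (subst (_≤ b) (+-comm a k) p)) (m≤n+m (b ∸ a) (a ∸ b))
gap-≥ {k} a b (inj₂ p) = ≤-trans (m+n≤o⇒m≤o∸n k (subst (_≤ a) (+-comm b k) p)) (m≤m+n (a ∸ b) (b ∸ a))

≥-gap : ∀ {k} a b → k ≤ ∣ a - b ∣ → a + k ≤ b ⊎ b + k ≤ a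
≥-gap {k} a b k≤ with ≤-total a b
... | inj₁ a≤b = inj₁ (subst (_≤ b) (+-comm k a) (m≤o∸n⇒m+n≤o k a≤b
      (subst (λ x → k ≤ x + (b ∸ a)) (m≤n⇒m∸n≡0 a≤b) k≤)))
... | inj₂ b≤a = inj₂ (subst (_≤ a) (+-comm k b) (m≤o∸n⇒m+n≤o k b≤a
      (subst (k ≤_) (trans (cong (a ∸ b +_) (m≤n⇒m∸n≡0 b≤a)) (+-identityʳ _)) k≤)))

not-T : ∀ b → bit (not b) + bit b ≡ 1
not-T true  = refl
not-T false = refl

count-complement : ∀ {n} (A : VSet n) → count (λ v → not (A v)) + count A ≡ 2 ^ n
count-complement {n} A = trans (sym (sumV-+ (λ v → bit (not (A v))) (λ v → bit (A v))))
  (trans (sumV-cong (λ v → not-T (A v))) (sumV-1 n))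

-- `W` collects the vertices of the first colour labelled from `a` to just before `c + k`; at least
-- `s` exist. Their neighbours in the other colour have labels below `c` or from `a + k` on, so s +
-- centralSum n ≤ O c + 2^n - O (a + k). Substitute 2^n = k + β and centralSum n = β + 1.
window-expands : ∀ {n k β s} (e o : Vertex n → ℕ) →
                 (∀ u v → hamming u v ≤ 1 → e u + k ≤ o v ⊎ o v + k ≤ e u) →
                 k + β ≡ 2 ^ n → suc β ≡ centralSum n → Expanding n s →
                 Expands k β s (λ x → count (below e x)) (λ x → count (below o x))
window-expands {n} {k} {β} {s} e o separated size drop expanding a c _ _ many =
  ≤-from
    (expanded +≤ few +≤ ≤-reflexive (count-complement {n} (below o (a + k))) +≤
     ≤-reflexive (sym size) +≤ ≤-reflexive drop)
    (solve 9 (λ k β s u K N p q r →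
      (s ⊕ (Κ 1 ⊕ p) ⊕ (N ⊕ (q ⊕ r ⊕ (K ⊕ (k ⊕ β ⊕ u)))))
      ⊜ (k ⊕ q ⊕ (s ⊕ u ⊕ (N ⊕ (r ⊕ p ⊕ (K ⊕ (Κ 1 ⊕ β))))))) refl
      k β s (centralSum n) (2 ^ n) (count (nb W)) (count (below o (a + k))) (count (below o c)) (count (λ v → not (below o (a + k) v))))
  where
  W : VSet n
  W v = (a ≤ᵇ e v) Bool.∧ (e v <ᵇ c + k)
  split : below e (c + k) ⊆ W ∪ below e a
  split v v∈ with e v <? a
  ... | yes lt = Equivalence.from (T-∨ {W v}) (inj₂ (<⇒<ᵇ lt))
  ... | no ≮a  = Equivalence.from (T-∨ {W v}) (inj₁ (Equivalence.from T-∧ (≤⇒≤ᵇ (≮⇒≥ ≮a) , v∈)))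
  s≤W : s ≤ count W
  s≤W = +-cancelˡ-≤ (count (below e a)) s (count W) (≤-trans many
    (≤-trans (count-mono {n} split) (≤-trans (count-∪ W (below e a)) (≤-reflexive (+-comm (count W) _)))))
  expanded : s + centralSum n ≤ count (nb W)
  expanded = expanding W s≤W
  outside : nb W ⊆ below o c ∪ (λ v → not (below o (a + k) v))
  outside v v∈ with nb⇒near W v v∈
  ... | u , near , u∈ with Equivalence.to T-∧ u∈
  ...   | a≤e , e<c+k with separated u v near
  ...     | inj₂ o+k≤e = Equivalence.from (T-∨ {below o c v}) (inj₁ (<⇒<ᵇ
              (+-cancelʳ-< k (o v) c (≤-trans (s≤s o+k≤e) (<ᵇ⇒< (e u) (c + k) e<c+k)))))
  ...     | inj₁ e+k≤o = Equivalence.from (T-∨ {below o c v}) (inj₂ (¬T⇒T-not λ p →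
              <⇒≱ (<ᵇ⇒< (o v) (a + k) p) (≤-trans (+-monoˡ-≤ k (≤ᵇ⇒≤ a (e u) a≤e)) e+k≤o)))
    where
    ¬T⇒T-not : ∀ {b} → ¬ T b → T (not b)
    ¬T⇒T-not {true}  ¬t = ¬t tt
    ¬T⇒T-not {false} _  = tt
  few : count (nb W) ≤ count (below o c) + count (λ v → not (below o (a + k) v))
  few = ≤-trans (count-mono {n} outside) (count-∪ (below o c) (λ v → not (below o (a + k) v)))

sumV-lift : ∀ {n} (f : Vertex (suc n) → ℕ) →
            sumV (λ v → f (lift false v)) + sumV (λ v → f (lift true v)) ≡ sumV f
sumV-lift {n} f = begin
  sumV (λ v → f (lift false v)) + sumV (λ v → f (lift true v))
    ≡⟨ sumV-+ {n} (λ v → f (lift false v)) (λ v → f (lift true v)) ⟨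
  sumV (λ v → f (lift false v) + f (lift true v))
    ≡⟨ sumV-cong (λ v → both v (parityOf v)) ⟩
  sumV (λ v → f (true ∷ v) + f (false ∷ v))
    ≡⟨ sumV-+ {n} (λ v → f (true ∷ v)) (λ v → f (false ∷ v)) ⟩
  sumV f ∎
  where
  open ≡-Reasoning
  both : ∀ v p → f ((false xor p) ∷ v) + f ((true xor p) ∷ v) ≡ f (true ∷ v) + f (false ∷ v)
  both v true  = refl
  both v false = +-comm (f (false ∷ v)) (f (true ∷ v))

labels-injective : ∀ {n} (η : Numbering n) {v w} → label η v ≡ label η w → v ≡ w
labels-injective η eq = Bijection.injective η (toℕ-injective eq)

class : ∀ {n} → Numbering (suc n) → Bool → Vertex n → ℕ
class η c v = label η (lift c v)

class-injective : ∀ {n} (η : Numbering (suc n)) c {v w} → class η c v ≡ class η c w → v ≡ w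
class-injective η c eq with labels-injective η eq
... | refl = refl

walk : ∀ {n k β} (η : Numbering (suc n)) → k + β ≡ 2 ^ n →
       Walk k β (λ x → count (below (class η false) x)) (λ x → count (below (class η true) x))
walk {n} {k} {β} η size = record
  { total  = λ x x≤ → trans (sumV-lift (λ v → bit (below (label η) x v)))
      (count-below (label η) (labels-injective η) bounded x (subst (x ≤_) top x≤))
  ; E-mono = rises false ; E-step = steps false ; O-mono = rises true ; O-step = steps true
  ; E-end = ends false ; O-end = ends true }
  where
  bounded : ∀ v → label η v < 2 ^ suc n
  bounded v = toℕ<n (Bijection.to η v)
  top : k + β + β + k ≡ 2 ^ suc n
  top = trans (regroup k β) (trans (cong₂ _+_ size size) (sym (2^suc n)))
    where
    regroup : ∀ k β → k + β + β + k ≡ k + β + (k + β)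
    regroup = solve-∀
  rises : ∀ c x → count (below (class η c) x) ≤ count (below (class η c) (suc x))
  rises c x = count-mono {n} λ v p → <⇒<ᵇ (m<n⇒m<1+n (<ᵇ⇒< (class η c v) x p))
  steps : ∀ c x → count (below (class η c) (suc x)) ≤ suc (count (below (class η c) x))
  steps c x = ≤-trans (count-below-step (class η c) (class-injective η c) x)
    (≤-trans (+-monoʳ-≤ _ (count-exactly (class η c) (class-injective η c) x)) (≤-reflexive (+-comm _ 1)))
  ends : ∀ c → count (below (class η c) (k + β + β + k)) ≡ k + β
  ends c = trans (≤-antisym (count≤2^n (below (class η c) (k + β + β + k)))
    (subst (_≤ count (below (class η c) (k + β + β + k))) (sumV-1 n)
      (sumV-mono λ v → bit-T (<⇒<ᵇ (subst (class η c v <_) (sym top) (bounded (lift c v)))))))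
    (sym size)

critical : ∀ n → ∃ λ a → ∃ λ b → Critical (suc n) a b
critical n with parity n
... | even h = _ , _ , critical-odd h
... | odd h  = _ , _ , critical-even h

spread-absurd : ∀ {n a b} → Critical n a b → 1 ≤ centralSum n → (η : Numbering (suc n)) →
                (∀ v w → Adj (suc n) v w → 2 ^ n ∸ centralSum n < ∣ label η v - label η w ∣) → ⊥
spread-absurd {n} K 1≤B η spread with centralSum n in eqB
... | suc β = walk-absurd (walk η size) (+-comm (suc t) (suc t′)) (s≤s low≤high) (s≤s gap)
      (expands false high drop-high) (expands false low drop-low) (expands true high drop-high)
  where
  open Critical K
  t  = pos (first high)
  t′ = pos (first low)
  -- The two set sizes are those of the initial segments ending at `first low` and `first high`. By
  -- `symmetric` their sum is 2^n - centralSum n + 1, the least gap assumed.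
  k  = suc t′ + suc t
  size : k + β ≡ 2 ^ n
  size = trans (regroup t′ t β) (trans (cong (λ B → t′ + t + suc B) (sym eqB)) symmetric)
    where
    regroup : ∀ t′ t β → suc t′ + suc t + β ≡ t′ + t + suc (suc β)
    regroup = solve-∀
  gap : t ≤ t′ + suc β
  gap = subst (λ B → t ≤ t′ + B) eqB high≤low
  k≡ : suc (2 ^ n ∸ suc β) ≡ k
  k≡ = trans (cong (λ x → suc (x ∸ suc β)) (trans (sym size) (+-assoc-suc)))
             (cong suc (m+n∸n≡m (t′ + suc t) (suc β)))
    where
    +-assoc-suc : suc t′ + suc t + β ≡ t′ + suc t + suc β
    +-assoc-suc = sym (+-suc (t′ + suc t) β)
  separated : ∀ c u v → hamming u v ≤ 1 →
              label η (lift c u) + k ≤ label η (lift (not c) v) ⊎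
              label η (lift (not c) v) + k ≤ label η (lift c u)
  separated c u v near = ≥-gap (label η (lift c u)) (label η (lift (not c) v))
    (subst (_≤ ∣ label η (lift c u) - label η (lift (not c) v) ∣) k≡
      (spread (lift c u) (lift (not c) v) (lift-adjacent c u v near)))
  expands : ∀ c v → pos (first v) + centralSum n ≡ pos v →
            Expands k β (suc (pos (first v))) (λ x → count (below (class η c) x))
                                              (λ x → count (below (class η (not c)) x))
  expands c v drop = window-expands (class η c) (class η (not c)) (separated c) size (sym eqB)
                       (critical-expanding v drop)

close-edge : ∀ n (η : Numbering (suc n)) → ∃ λ v → ∃ λ w →
             Adj (suc n) v w × ∣ label η v - label η w ∣ ≤ 2 ^ n ∸ centralSum n
-- The sum is empty here and has no predecessor `β`, so the single edge is treated directly.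
close-edge zero η = true ∷ [] , false ∷ [] , refl ,
  near (toℕ<n (Bijection.to η (true ∷ []))) (toℕ<n (Bijection.to η (false ∷ [])))
  where
  near : ∀ {a b} → a < 2 → b < 2 → ∣ a - b ∣ ≤ 1
  near (s≤s z≤n)       (s≤s z≤n)       = z≤n
  near (s≤s z≤n)       (s≤s (s≤s z≤n)) = ≤-refl
  near (s≤s (s≤s z≤n)) (s≤s z≤n)       = ≤-refl
  near (s≤s (s≤s z≤n)) (s≤s (s≤s z≤n)) = z≤n
close-edge (suc m) η with any-vertex? (λ v → any-vertex? (λ w →
    (hamming v w ≟ 1) ×-dec (∣ label η v - label η w ∣ ≤? 2 ^ suc m ∸ centralSum (suc m))))
... | yes p = p
... | no none = ⊥-elim (spread-absurd (proj₂ (proj₂ (critical m)))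
      -- The last summand is at least `m C 0`, which is one.
      (≤-trans (C≤central m 0) (m≤n+m _ (centralSum m))) η
      λ v w adj → ≰⇒> λ close → none (v , w , adj , close))

-- The numbering that attains the bound

place : ∀ {n} → Vertex (suc n) → ℕ
place {n} (b ∷ v) = val (b xor parityOf v) (2 ^ n) + pos v

place-bounded : ∀ {n} (v : Vertex (suc n)) → place v < 2 ^ suc n
place-bounded {n} (b ∷ v) = subst (place (b ∷ v) <_) (sym (2^suc n))
  (+-mono-≤-< (val≤ (b xor parityOf v)) (pos<2^n v))
  where
  val≤ : ∀ c → val c (2 ^ n) ≤ 2 ^ n
  val≤ true  = ≤-refl
  val≤ false = z≤n

place-injective : ∀ {n} {v w : Vertex (suc n)} → place v ≡ place w → v ≡ w
place-injective {n} {b ∷ v} {c ∷ w} eq = finish (cases (b xor parityOf v) (c xor parityOf w) eq)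
  where
  cases : ∀ p q → val p (2 ^ n) + pos v ≡ val q (2 ^ n) + pos w → p ≡ q × pos v ≡ pos w
  cases true  true  eq = refl , +-cancelˡ-≡ (2 ^ n) (pos v) (pos w) eq
  cases false false eq = refl , eq
  cases true  false eq = contradiction (m≤m+n (2 ^ n) (pos v)) (<⇒≱ (subst (_< 2 ^ n) (sym eq) (pos<2^n w)))
  cases false true  eq = contradiction (m≤m+n (2 ^ n) (pos w)) (<⇒≱ (subst (_< 2 ^ n) eq (pos<2^n v)))
  xor-cancel : ∀ b c p → b xor p ≡ c xor p → b ≡ c
  xor-cancel true  true  _     _ = refl
  xor-cancel false false _     _ = refl
  xor-cancel true  false true  ()
  xor-cancel true  false false ()
  xor-cancel false true  true  ()
  xor-cancel false true  false ()
  finish : (b xor parityOf v) ≡ (c xor parityOf w) × pos v ≡ pos w → b ∷ v ≡ c ∷ w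
  finish (p≡q , v≡w) with pos-injective {v = v} {w} v≡w
  ... | refl = cong (_∷ v) (xor-cancel b c (parityOf v) p≡q)

numbering : ∀ n → Numbering (suc n)
numbering n = mk⤖ {to = to} (injective , surj)
  where
  to : Vertex (suc n) → Fin (2 ^ suc n)
  to v = fromℕ< (place-bounded v)
  toℕ-to : ∀ v → toℕ (to v) ≡ place v
  toℕ-to v = toℕ-fromℕ< (place-bounded v)
  injective : ∀ {v w} → to v ≡ to w → v ≡ w
  injective {v} {w} eq = place-injective (trans (sym (toℕ-to v)) (trans (cong toℕ eq) (toℕ-to w)))
  surj : ∀ y → ∃ λ v → ∀ {z} → z ≡ v → to z ≡ y
  surj y with surjective {suc n} place place-injective place-bounded (toℕ y) (toℕ<n y)
  ... | v , eq = v , λ { refl → toℕ-injective (trans (toℕ-to v) eq) }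

-- Read off the symmetry of the critical pair; it makes the truncated subtraction in the theorem a
-- true one.
centralSum≤2^n : ∀ n → centralSum n ≤ 2 ^ n
centralSum≤2^n zero    = z≤n
centralSum≤2^n (suc m) = subst (centralSum (suc m) ≤_) (Critical.symmetric (proj₂ (proj₂ (critical m))))
  (≤-trans (n≤1+n _) (m≤n+m _ _))

hamming-sym : ∀ {n} (u v : Vertex n) → hamming u v ≡ hamming v u
hamming-sym []          []          = refl
hamming-sym (true  ∷ u) (true  ∷ v) = hamming-sym u v
hamming-sym (false ∷ u) (false ∷ v) = hamming-sym u v
hamming-sym (true  ∷ u) (false ∷ v) = cong suc (hamming-sym u v)
hamming-sym (false ∷ u) (true  ∷ v) = cong suc (hamming-sym u v)

hamming-tail : ∀ {n} b c (u v : Vertex n) → hamming u v ≤ hamming (b ∷ u) (c ∷ v)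
hamming-tail true  true  u v = ≤-refl
hamming-tail false false u v = ≤-refl
hamming-tail true  false u v = n≤1+n _
hamming-tail false true  u v = n≤1+n _

bandwidth : ∀ {n} (u v : Vertex n) → hamming u v ≤ 1 → pos v ≤ pos u + centralSum n
bandwidth {n} u v near =
  ≤-trans (pos≤first+centralSum v) (+-monoˡ-≤ (centralSum n) (first-least {u = u} {v} near))

numbering-spread : ∀ n → AllEdgesAtLeast (suc n) (numbering n) (2 ^ n ∸ centralSum n)
numbering-spread n (b ∷ v) (c ∷ w) adj = subst₂ (λ x y → 2 ^ n ∸ centralSum n ≤ ∣ x - y ∣)
  (sym (toℕ-fromℕ< (place-bounded (b ∷ v)))) (sym (toℕ-fromℕ< (place-bounded (c ∷ w))))
  (cases (b xor parityOf v) (c xor parityOf w) (hamming1⇒parity (b ∷ v) (c ∷ w) adj))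
  where
  near : hamming v w ≤ 1
  near = subst (hamming v w ≤_) adj (hamming-tail b c v w)
  near′ : hamming w v ≤ 1
  near′ = subst (_≤ 1) (hamming-sym v w) near
  room : ∀ {x y} → x ≤ y + centralSum n → x + (2 ^ n ∸ centralSum n) ≤ 2 ^ n + y
  room {x} {y} x≤ = ≤-from (x≤ +≤ ≤-reflexive (m∸n+n≡m (centralSum≤2^n n)))
    (solve 5 (λ x y K u r →
      (x ⊕ r ⊕ (y ⊕ u ⊕ K))
      ⊜ (K ⊕ y ⊕ (x ⊕ (r ⊕ u)))) refl
      x y (2 ^ n) (centralSum n) (2 ^ n ∸ centralSum n))
  cases : ∀ p q → p ≡ not q →
          2 ^ n ∸ centralSum n ≤ ∣ val p (2 ^ n) + pos v - (val q (2 ^ n) + pos w) ∣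
  cases true  false _ = gap-≥ (2 ^ n + pos v) (pos w)
    (inj₂ (room (bandwidth v w near)))
  cases false true  _ = gap-≥ (pos v) (2 ^ n + pos w)
    (inj₁ (room (bandwidth w v near′)))

theorem3 : ∀ (n : ℕ) → AntibandwidthCubeIs (suc n) (2 ^ n ∸ centralSum n)
theorem3 n = (numbering n , numbering-spread n) , close-edge n
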